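{- Let $d\ge1$ be an integer and let ${\cal A}_d$ be an optimal tristance anticode of diameter $d$ in the hexagonal graph. Then $$|{\cal A}_d| = \left\lceil \frac{d^2+3d+2}{3}\right\rceil = \left\lceil \frac{(d+1)(d+2)}{3}\right\rceil .$$ Moreover, up to rotation by an angle of $\pi/3$ and translation, ${\cal A}_d={\mathscr H}(a,b,c,c)$ where, depending on $r=d\bmod 3$: $r=0$: $(a,b,c)=(\tfrac{2d}{3},\tfrac{2d}{3},\tfrac{d}{3})$; $r=1$: $(a,b,c)$ is one of $(\tfrac{2d+1}{3},\tfrac{2d+1}{3},\tfrac{d+2}{3})$ or $(\tfrac{2d+1}{3},\tfrac{2d-2}{3},\tfrac{d-1}{3})$; $r=2$: $(a,b,c)$ is one of $(\tfrac{2d-1}{3},\tfrac{2d-1}{3},\tfrac{d-2}{3})$ or $(\tfrac{2d+2}{3},\tfrac{2d-1}{3},\tfrac{d+1}{3})$.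
   Context: Let $\omega=-\tfrac12+\tfrac{\sqrt3}{2}i$. The hexagonal lattice is $A_2=\{x+\omega y: x,y\in\mathbb{Z}\}$, and the point $x+\omega y$ is written $(x,y)$. The hexagonal graph has vertex set $A_2$, two points being adjacent iff their Euclidean distance (in $\mathbb{C}$) is $1$; equivalently, $(x,y)$ is adjacent to $(x\pm1,y)$, $(x,y\pm1)$, $(x+1,y+1)$, $(x-1,y-1)$. The tristance of three points of $A_2$ is the minimum number of edges of a tree in the hexagonal graph (possibly using additional vertices) containing them. A set ${\cal A}\subset A_2$ is a tristance anticode of diameter $d$ if the tristance of any three of its points is at most $d$; it is optimal if it has largest possible cardinality among such sets. For integers $a,b,c_1,c_3$, ${\mathscr H}(a,b,c_1,c_3)$ denotes the set of $(x,y)\in A_2$ with $0\le x\le a$, $0\le y\le b$, $c_3-b\le x-y\le a-c_1$. -}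

module Defs where

open import Data.Nat as ℕ using (ℕ; zero; suc)
open import Data.Nat.DivMod using (_/_; _%_)
open import Data.Integer as ℤ using (ℤ; +_; _-_; _+_; _≤_)
open import Data.Product using (_×_; _,_; ∃; ∃-syntax; Σ-syntax)
open import Data.List using (List; []; _∷_; length)
open import Data.List.Membership.Propositional using (_∈_; _∉_)
open import Data.List.Relation.Unary.Unique.Propositional using (Unique)
open import Relation.Binary.PropositionalEquality using (_≡_)

-- A point (x , y) of A₂ stands for x + ω y.
Point : Set
Point = ℤ × ℤ

-- Adjacency in the hexagonal graph (Euclidean distance 1).
data Adj : Point → Point → Set where
  adj+x  : ∀ x y → Adj (x , y) (x + + 1 , y)
  adj-x  : ∀ x y → Adj (x , y) (x - + 1 , y)
  adj+y  : ∀ x y → Adj (x , y) (x , y + + 1)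
  adj-y  : ∀ x y → Adj (x , y) (x , y - + 1)
  adj+xy : ∀ x y → Adj (x , y) (x + + 1 , y + + 1)
  adj-xy : ∀ x y → Adj (x , y) (x - + 1 , y - + 1)

-- Finite subtrees of the hexagonal graph, given by their vertex list and
-- number of edges, built inductively: a single vertex is a tree, and
-- attaching a new vertex w by an edge to a vertex u of a tree gives a tree.
data Tree : List Point → ℕ → Set where
  single : ∀ v → Tree (v ∷ []) 0
  grow   : ∀ {vs k u w} → Tree vs k → u ∈ vs → w ∉ vs → Adj u w →
           Tree (w ∷ vs) (suc k)

TristanceAtMost : Point → Point → Point → ℕ → Set
TristanceAtMost p q r d =
  ∃[ vs ] ∃[ k ] (Tree vs k × p ∈ vs × q ∈ vs × r ∈ vs × k ℕ.≤ d)

IsAnticode : ℕ → List Point → Set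
IsAnticode d A = Unique A ×
  (∀ {p q r} → p ∈ A → q ∈ A → r ∈ A → TristanceAtMost p q r d)

IsOptimalAnticode : ℕ → List Point → Set
IsOptimalAnticode d A = IsAnticode d A ×
  (∀ B → IsAnticode d B → length B ℕ.≤ length A)

InH : ℤ → ℤ → ℤ → ℤ → Point → Set
InH a b c₁ c₃ (x , y) =
  (+ 0 ≤ x × x ≤ a) × (+ 0 ≤ y × y ≤ b) × (c₃ - b ≤ x - y × x - y ≤ a - c₁)

-- Rotation by π/3 : multiplication by 1 + ω, (x + ωy)(1 + ω) = (x - y) + ω x.
rot : Point → Point
rot (x , y) = (x - y , x)

rotN : ℕ → Point → Point
rotN zero p = p
rotN (suc k) p = rot (rotN k p)

translate : Point → Point → Point
translate (s , t) (x , y) = (x + s , y + t)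

ceil3 : ℕ → ℕ
ceil3 n = (n ℕ.+ 2) / 3

shapes : ℕ → List (ℕ × ℕ × ℕ)
shapes d with d % 3
... | 0 = ((2 ℕ.* d) / 3 , (2 ℕ.* d) / 3 , d / 3) ∷ []
... | 1 = ((2 ℕ.* d ℕ.+ 1) / 3 , (2 ℕ.* d ℕ.+ 1) / 3 , (d ℕ.+ 2) / 3)
        ∷ ((2 ℕ.* d ℕ.+ 1) / 3 , (2 ℕ.* d ℕ.∸ 2) / 3 , (d ℕ.∸ 1) / 3) ∷ []
... | _ = ((2 ℕ.* d ℕ.∸ 1) / 3 , (2 ℕ.* d ℕ.∸ 1) / 3 , (d ℕ.∸ 2) / 3)
        ∷ ((2 ℕ.* d ℕ.+ 2) / 3 , (2 ℕ.* d ℕ.∸ 1) / 3 , (d ℕ.+ 1) / 3) ∷ []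

{-# OPTIONS --safe #-}

-- With f₁ = x, f₂ = - y and f₃ = y - x, the tristance of p, q, r is the larger
-- of max f₁ + max f₂ + max f₃ and - (min f₁ + min f₂ + min f₃) over the three
-- points.  Hence A is an anticode of diameter d iff its bounding hexagon
-- nᵢ ≤ fᵢ ≤ Mᵢ satisfies M₁ + M₂ + M₃ ≤ d and - (n₁ + n₂ + n₃) ≤ d, and an
-- optimal A is its whole bounding hexagon.  That hexagon is a triangle of side
-- S = M₁ + M₂ + M₃ with corners of sizes t₁, t₂, t₃ removed, so
--   2 |A| + Σ tᵢ (tᵢ + 1) ≤ (S + 1) (S + 2),
-- where Σ tᵢ = 2 S + n₁ + n₂ + n₃.  Up to negation Σ tᵢ ≥ S, and comparing with
-- an explicit anticode forces S = Σ tᵢ = d and Σ (tᵢ - tⱼ)² ≤ 2: the three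
-- corners are as equal as possible, which leaves the listed shapes.
module Submission where

open import Defs
open import Data.Nat as ℕ using (ℕ; zero; suc; z≤n; s≤s)
import Data.Nat.Properties as ℕ
open import Data.Nat.DivMod
  using (_/_; _%_; m*n%n≡0; [m+kn]%n≡m%n; m*n/n≡m; /-monoˡ-≤; m<n*o⇒m/o<n; m≡m%n+[m/n]*n; m%n<n)
import Data.Nat.Tactic.RingSolver as ℕR
open import Data.Integer as ℤ
  using (ℤ; +_; -[1+_]; 0ℤ; 1ℤ; -1ℤ; _+_; _*_; -_; _-_; _≤_; _⊔_; ∣_∣; +≤+; -≤+)
open import Data.Integer.Properties
open import Data.Integer.Tactic.RingSolver using (solve; solve-∀)
open import Algebra.Properties.AbelianGroup +-0-abelianGroup
  using () renaming (∙-cancelˡ to +-cancelˡ; ∙-cancelʳ to +-cancelʳ)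
open import Data.Product using (_×_; _,_; ∃-syntax; proj₁; proj₂; map₂)
open import Data.Product.Properties using (≡-dec)
open import Data.Sum using (_⊎_; inj₁; inj₂)
open import Data.Empty using (⊥)
open import Data.List using (List; []; _∷_; length; map; _++_; upTo; filter)
open import Data.List.Properties using (length-++; length-map; length-upTo)
open import Data.List.Extrema ≤-totalOrder
  using (argmax; argmax-sel; f[⊥]≤f[argmax]; f[xs]≤f[argmax])
open import Data.List.Membership.Propositional using (_∈_)
open import Data.List.Membership.Propositional.Properties
  using (∈-∃++; ∈-++⁺ˡ; ∈-++⁺ʳ; ∈-++⁻; ∈-map⁺; ∈-map⁻; ∈-upTo⁺; ∈-upTo⁻; ∈-filter⁺; ∈-filter⁻)
open import Data.List.Relation.Binary.Subset.Propositional using (_⊆_)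
open import Data.List.Relation.Binary.Disjoint.Propositional using (Disjoint)
open import Data.List.Relation.Unary.Any using (here; there)
import Data.List.Relation.Unary.All as All
import Data.List.Relation.Unary.All.Properties as All
open import Data.List.Relation.Unary.Unique.Propositional using (Unique; []; _∷_)
import Data.List.Relation.Unary.Unique.Propositional.Properties as Unique
open import Function using (_∘_; id)
open import Function.Bundles using (_⇔_; mk⇔)
import Function.Properties.Equivalence as ⇔
open import Relation.Nullary using (Dec; yes; no; contradiction; ¬_)
open import Relation.Nullary.Decidable using (_×-dec_)
open import Relation.Binary.Definitions using (DecidableEquality)
open import Relation.Binary.PropositionalEquality
  using (_≡_; refl; sym; trans; cong; cong₂; subst; subst₂; module ≡-Reasoning)

-- Everything hinges on one constant. Corners of total side σ satisfy 3 Σ tᵢ (tᵢ + 1) = σ² + 3σ + Q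
-- with Q = Σ (tᵢ - tⱼ)². Inserting this and 3 |A| ≥ (d + 1)(d + 2) into the counting inequality,
-- with d = S + e and σ = S + g, leaves 4Se + 2e² + 6e + 2Sg + g² + 3g + Q ≤ 2. Every term on the
-- left is nonnegative, so integrality gives e = g = 0, and then Q ≤ 2. Hence the explicit anticode
-- B only has to satisfy 3 |B| ≥ (d + 1)(d + 2); the exact cardinality follows because 3 |A| can
-- exceed this number by at most 1. The sign of g is the reason for the negation: σ - S equals
-- `upSize` minus `downSize`, the sides of the two opposite triangles around A, and negation
-- exchanges them. Once both sides are d, the six bounds nᵢ and Mᵢ sum to 0, which is exactly what
-- makes c₁ and c₃ equal in the normal form.

infixl 6 _⊕_
_⊕_ : ∀ {a b c d} → a ≤ b → c ≤ d → a + c ≤ b + d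
_⊕_ = +-mono-≤

-- Abstract because evaluating these proofs makes type checking infeasible.
abstract
  linear : ∀ {a b c d} → a ≤ b → c - d ≡ a - b → c ≤ d
  linear a≤b eq = i-j≤0⇒i≤j (subst (_≤ 0ℤ) (sym eq) (i≤j⇒i-j≤0 a≤b))

eq≤ : ∀ {a b} → a ≡ b → a ≤ b
eq≤ = ≤-reflexive

eq≥ : ∀ {a b} → a ≡ b → b ≤ a
eq≥ = ≤-reflexive ∘ sym

-- Coordinates of sum zero and the lower bound on tree size.

f₁ f₂ f₃ : Point → ℤ
f₁ (x , y) = x
f₂ (x , y) = - y
f₃ (x , y) = y - x

Close : (Point → ℤ) → Set
Close g = ∀ {u w} → Adj u w → g u ≤ g w + 1ℤ × g w ≤ g u + 1ℤ

-- Isolates what the tree bound uses, so that it applies both to the `fᵢ`, for maxima, and to their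
-- negatives, for minima.
record ZeroSumTriple (g₁ g₂ g₃ : Point → ℤ) : Set where
  field
    sum≡0  : ∀ p → g₁ p + g₂ p + g₃ p ≡ 0ℤ
    close₁ : Close g₁
    close₂ : Close g₂
    close₃ : Close g₃

module _ {g₁ g₂ g₃ : Point → ℤ} (T : ZeroSumTriple g₁ g₂ g₃) where
  open ZeroSumTriple T

  private
    one₁ : ∀ a a′ b c k → a′ ≤ a + 1ℤ → a + b + c ≤ k → a′ + b + c ≤ 1ℤ + k
    one₁ a a′ b c k h₁ h₂ = linear (h₁ ⊕ h₂) (solve (a ∷ a′ ∷ b ∷ c ∷ k ∷ []))

    one₂ : ∀ a b b′ c k → b′ ≤ b + 1ℤ → a + b + c ≤ k → a + b′ + c ≤ 1ℤ + k
    one₂ a b b′ c k h₁ h₂ = linear (h₁ ⊕ h₂) (solve (a ∷ b ∷ b′ ∷ c ∷ k ∷ []))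

    one₃ : ∀ a b c c′ k → c′ ≤ c + 1ℤ → a + b + c ≤ k → a + b + c′ ≤ 1ℤ + k
    one₃ a b c c′ k h₁ h₂ = linear (h₁ ⊕ h₂) (solve (a ∷ b ∷ c ∷ c′ ∷ k ∷ []))

    two : ∀ a b c a′ b′ c′ r k → a + b + c ≡ 0ℤ → a′ + b′ + c′ ≡ 0ℤ →
          c ≤ c′ + 1ℤ → r + a + b ≤ k → r + a′ + b′ ≤ 1ℤ + k
    two a b c a′ b′ c′ r k h₁ h₂ h₃ h₄ =
      linear (h₃ ⊕ h₄ ⊕ eq≤ h₂ ⊕ eq≥ h₁)
             (solve (a ∷ b ∷ c ∷ a′ ∷ b′ ∷ c′ ∷ r ∷ k ∷ []))

    cab : ∀ a b c → a + b + c ≡ c + a + b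
    cab = solve-∀

    bac : ∀ a b c → a + b + c ≡ b + a + c
    bac = solve-∀

    acb : ∀ a b c → a + b + c ≡ a + c + b
    acb = solve-∀

  -- When two of the three points are the new leaf w, the zero sum trades
  -- the two functionals at w for the third one, so the bound still rises
  -- by at most 1.
  tree-bound : ∀ {vs k p q r} → Tree vs k → p ∈ vs → q ∈ vs → r ∈ vs →
               g₁ p + g₂ q + g₃ r ≤ + k
  tree-bound (single v) (here refl) (here refl) (here refl) = eq≤ (sum≡0 v)
  tree-bound (grow {w = w} t u∈ _ e) (here refl) (here refl) (here refl) =
    subst (_≤ _) (sym (sum≡0 w)) (+≤+ z≤n)
  tree-bound {r = r} (grow {k = k} {u} {w} t u∈ _ e) (here refl) (here refl) (there r∈) =
    subst (_≤ _) (sym (cab (g₁ w) (g₂ w) (g₃ r)))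
      (two (g₁ u) (g₂ u) (g₃ u) (g₁ w) (g₂ w) (g₃ w) (g₃ r) (+ k)
        (sum≡0 u) (sum≡0 w) (proj₁ (close₃ e))
        (subst (_≤ _) (cab (g₁ u) (g₂ u) (g₃ r)) (tree-bound t u∈ u∈ r∈)))
  tree-bound {q = q} (grow {k = k} {u} {w} t u∈ _ e) (here refl) (there q∈) (here refl) =
    subst (_≤ _) (bac (g₂ q) (g₁ w) (g₃ w))
      (two (g₁ u) (g₃ u) (g₂ u) (g₁ w) (g₃ w) (g₂ w) (g₂ q) (+ k)
        (trans (acb (g₁ u) (g₃ u) (g₂ u)) (sum≡0 u))
        (trans (acb (g₁ w) (g₃ w) (g₂ w)) (sum≡0 w)) (proj₁ (close₂ e))
        (subst (_≤ _) (bac (g₁ u) (g₂ q) (g₃ u)) (tree-bound t u∈ q∈ u∈)))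
  tree-bound {p = p} (grow {k = k} {u} {w} t u∈ _ e) (there p∈) (here refl) (here refl) =
    two (g₂ u) (g₃ u) (g₁ u) (g₂ w) (g₃ w) (g₁ w) (g₁ p) (+ k)
      (trans (cab (g₂ u) (g₃ u) (g₁ u)) (sum≡0 u))
      (trans (cab (g₂ w) (g₃ w) (g₁ w)) (sum≡0 w))
      (proj₁ (close₁ e)) (tree-bound t p∈ u∈ u∈)
  tree-bound {q = q} {r} (grow {k = k} {u} {w} t u∈ _ e) (here refl) (there q∈) (there r∈) =
    one₁ (g₁ u) (g₁ w) (g₂ q) (g₃ r) (+ k) (proj₂ (close₁ e)) (tree-bound t u∈ q∈ r∈)
  tree-bound {p = p} {r = r} (grow {k = k} {u} {w} t u∈ _ e) (there p∈) (here refl) (there r∈) =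
    one₂ (g₁ p) (g₂ u) (g₂ w) (g₃ r) (+ k) (proj₂ (close₂ e)) (tree-bound t p∈ u∈ r∈)
  tree-bound {p = p} {q} (grow {k = k} {u} {w} t u∈ _ e) (there p∈) (there q∈) (here refl) =
    one₃ (g₁ p) (g₂ q) (g₃ u) (g₃ w) (+ k) (proj₂ (close₃ e)) (tree-bound t p∈ q∈ u∈)
  tree-bound (grow t _ _ _) (there p∈) (there q∈) (there r∈) =
    ≤-trans (tree-bound t p∈ q∈ r∈) (+≤+ (ℕ.n≤1+n _))

Small : ℤ → Set
Small z = -1ℤ ≤ z × z ≤ 1ℤ

step-small : ∀ {u w} → Adj u w →
  ∃[ δ ] w ≡ translate δ u × Small (f₁ δ) × Small (f₂ δ) × Small (f₃ δ)
step-small = λ where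
    (adj+x x y)  → (1ℤ , 0ℤ) , cong (x + 1ℤ ,_) (sym (+-identityʳ y)) , s⁺ , s⁰ , s⁻
    (adj-x x y)  → (-1ℤ , 0ℤ) , cong (x - 1ℤ ,_) (sym (+-identityʳ y)) , s⁻ , s⁰ , s⁺
    (adj+y x y)  → (0ℤ , 1ℤ) , cong (_, y + 1ℤ) (sym (+-identityʳ x)) , s⁰ , s⁻ , s⁺
    (adj-y x y)  → (0ℤ , -1ℤ) , cong (_, y - 1ℤ) (sym (+-identityʳ x)) , s⁰ , s⁺ , s⁻
    (adj+xy x y) → (1ℤ , 1ℤ) , refl , s⁺ , s⁻ , s⁰
    (adj-xy x y) → (-1ℤ , -1ℤ) , refl , s⁻ , s⁺ , s⁰
  where
  s⁺ : Small 1ℤ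
  s⁺ = -≤+ , ≤-refl
  s⁰ : Small 0ℤ
  s⁰ = -≤+ , +≤+ z≤n
  s⁻ : Small -1ℤ
  s⁻ = ≤-refl , -≤+

small-close : ∀ {a b} ε → b ≡ a + ε → Small ε → a ≤ b + 1ℤ × b ≤ a + 1ℤ
small-close {a} ε refl (l , h) =
  linear l (solve (a ∷ ε ∷ [])) , linear h (solve (a ∷ ε ∷ []))

close-f₁ : Close f₁
close-f₁ {x , y} e with step-small e
... | (s , t) , refl , small , _ , _ = small-close s refl small

close-f₂ : Close f₂
close-f₂ {x , y} e with step-small e
... | (s , t) , refl , _ , small , _ = small-close (- t) (neg-distrib-+ y t) small

close-f₃ : Close f₃
close-f₃ {x , y} e with step-small e
... | (s , t) , refl , _ , _ , small = small-close (t - s) eq small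
  where
  eq : y + t - (x + s) ≡ y - x + (t - s)
  eq = solve (x ∷ y ∷ s ∷ t ∷ [])

close-neg : ∀ {g} → Close g → Close (-_ ∘ g)
close-neg {g} close {u} {w} e = swap (g u) (g w) (close e)
  where
  swap : ∀ a b → a ≤ b + 1ℤ × b ≤ a + 1ℤ → - a ≤ - b + 1ℤ × - b ≤ - a + 1ℤ
  swap a b (h₁ , h₂) = linear h₂ (solve (a ∷ b ∷ [])) , linear h₁ (solve (a ∷ b ∷ []))

f-sum : ∀ p → f₁ p + f₂ p + f₃ p ≡ 0ℤ
f-sum (x , y) = eq
  where
  eq : x + - y + (y - x) ≡ 0ℤ
  eq = solve (x ∷ y ∷ [])

f-triple : ZeroSumTriple f₁ f₂ f₃
f-triple = record { sum≡0 = f-sum ; close₁ = close-f₁ ; close₂ = close-f₂ ; close₃ = close-f₃ }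

neg-triple : ZeroSumTriple (-_ ∘ f₁) (-_ ∘ f₂) (-_ ∘ f₃)
neg-triple = record
  { sum≡0 = λ p → trans (neg-sum (f₁ p) (f₂ p) (f₃ p)) (cong -_ (f-sum p))
  ; close₁ = close-neg close-f₁ ; close₂ = close-neg close-f₂ ; close₃ = close-neg close-f₃ }
  where
  neg-sum : ∀ a b c → - a + - b + - c ≡ - (a + b + c)
  neg-sum = solve-∀

-- Walks and the upper bound on distances.

data Walk : Point → Point → ℕ → Set where
  []  : ∀ {u} → Walk u u 0
  _∷_ : ∀ {u v w n} → Adj u v → Walk v w n → Walk u w (suc n)

_++ʷ_ : ∀ {u v w m n} → Walk u v m → Walk v w n → Walk u w (m ℕ.+ n)
[]      ++ʷ q = q
(e ∷ p) ++ʷ q = e ∷ (p ++ʷ q)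

Direction : Point → Set
Direction δ = ∀ u → Adj u (translate δ u)

_·_ : ℤ → Point → Point
a · (s , t) = a * s , a * t

line : ∀ {δ} → Direction δ → ∀ n u → Walk u (translate ((+ n) · δ) u) n
line {s , t} dir zero (x , y) = subst (λ w → Walk (x , y) w 0) (sym (cong₂ _,_ (eq x s) (eq y t))) []
  where
  eq : ∀ x s → x + 0ℤ * s ≡ x
  eq = solve-∀
line {s , t} dir (suc n) (x , y) = dir (x , y) ∷
  subst (λ w → Walk _ w n) (cong₂ _,_ (eq x s (+ n)) (eq y t (+ n))) (line dir n (x + s , y + t))
  where
  eq : ∀ x s m → x + s + m * s ≡ x + (1ℤ + m) * s
  eq = solve-∀

dir+x : Direction (1ℤ , 0ℤ)
dir+x (x , y) = subst (λ z → Adj (x , y) (x + 1ℤ , z)) (sym (+-identityʳ y)) (adj+x x y)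

dir-x : Direction (-1ℤ , 0ℤ)
dir-x (x , y) = subst (λ z → Adj (x , y) (x - 1ℤ , z)) (sym (+-identityʳ y)) (adj-x x y)

dir+y : Direction (0ℤ , 1ℤ)
dir+y (x , y) = subst (λ z → Adj (x , y) (z , y + 1ℤ)) (sym (+-identityʳ x)) (adj+y x y)

dir-y : Direction (0ℤ , -1ℤ)
dir-y (x , y) = subst (λ z → Adj (x , y) (z , y - 1ℤ)) (sym (+-identityʳ x)) (adj-y x y)

dir+xy : Direction (1ℤ , 1ℤ)
dir+xy (x , y) = adj+xy x y

dir-xy : Direction (-1ℤ , -1ℤ)
dir-xy (x , y) = adj-xy x y

infix 8 _⁺
_⁺ : ℤ → ℤ
z ⁺ = z ⊔ 0ℤ

excess : Point → Point → ℤ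
excess u w = (f₁ w - f₁ u) ⁺ + (f₂ w - f₂ u) ⁺ + (f₃ w - f₃ u) ⁺

-- The two excesses agree because f₁ + f₂ + f₃ ≡ 0, and they are the
-- distance; only the upper bound on the distance is needed.
ShortWalk : Point → Point → Set
ShortWalk u w = ∃[ n ] Walk u w n × + n ≤ excess u w × + n ≤ excess w u

zigzag : ∀ {δ δ′ u w a b} → Direction δ → Direction δ′ → 0ℤ ≤ a → 0ℤ ≤ b →
         w ≡ translate (b · δ′) (translate (a · δ) u) →
         a + b ≤ excess u w → a + b ≤ excess w u → ShortWalk u w
zigzag {a = + m} {+ n} dir dir′ _ _ refl h h′ = m ℕ.+ n , line dir m _ ++ʷ line dir′ n _ , h , h′

adj-sym : ∀ {u w} → Adj u w → Adj w u
adj-sym = λ where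
    (adj+x x y)  → subst (λ z → Adj (x + 1ℤ , y) (z , y)) (there-back x) (adj-x (x + 1ℤ) y)
    (adj-x x y)  → subst (λ z → Adj (x - 1ℤ , y) (z , y)) (back-there x) (adj+x (x - 1ℤ) y)
    (adj+y x y)  → subst (λ z → Adj (x , y + 1ℤ) (x , z)) (there-back y) (adj-y x (y + 1ℤ))
    (adj-y x y)  → subst (λ z → Adj (x , y - 1ℤ) (x , z)) (back-there y) (adj+y x (y - 1ℤ))
    (adj+xy x y) → subst₂ (λ z t → Adj (x + 1ℤ , y + 1ℤ) (z , t)) (there-back x) (there-back y)
                     (adj-xy (x + 1ℤ) (y + 1ℤ))
    (adj-xy x y) → subst₂ (λ z t → Adj (x - 1ℤ , y - 1ℤ) (z , t)) (back-there x) (back-there y)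
                     (adj+xy (x - 1ℤ) (y - 1ℤ))
  where
  there-back : ∀ z → z + 1ℤ - 1ℤ ≡ z
  there-back = solve-∀
  back-there : ∀ z → z - 1ℤ + 1ℤ ≡ z
  back-there = solve-∀

reverseʷ : ∀ {u w n} → Walk u w n → Walk w u n
reverseʷ []                  = []
reverseʷ {n = suc n} (e ∷ p) = subst (Walk _ _) (ℕ.+-comm n 1) (reverseʷ p ++ʷ (adj-sym e ∷ []))

short-walk-sym : ∀ {u w} → ShortWalk u w → ShortWalk w u
short-walk-sym (n , p , h , h′) = n , reverseʷ p , h′ , h

private
  z≤z⁺ : ∀ z → z ≤ z ⁺
  z≤z⁺ z = i≤i⊔j z 0ℤ

  0≤z⁺ : ∀ z → 0ℤ ≤ z ⁺
  0≤z⁺ z = i≤j⊔i z 0ℤ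

  split : ∀ {s a b c p q r} → p ≤ a ⁺ → q ≤ b ⁺ → r ≤ c ⁺ → s ≡ p + q + r → s ≤ a ⁺ + b ⁺ + c ⁺
  split h₁ h₂ h₃ refl = h₁ ⊕ h₂ ⊕ h₃

module _ (x y x′ y′ : ℤ) where
  private
    v₁ v₂ v₃ w₁ w₂ w₃ : ℤ
    v₁ = x′ - x
    v₂ = - y′ - - y
    v₃ = (y′ - x′) - (y - x)
    w₁ = x - x′
    w₂ = - y - - y′
    w₃ = (y - x) - (y′ - x′)

  -- Every edge raises one `fᵢ` by 1, lowers another by 1 and fixes the third. Here only edges are
  -- used that raise `f₁` or `f₂` and lower `f₃`. Their number is `v₁ + v₂`, which is also the total
  -- drop of `f₃`, the only term needed from the excess in the other direction.
  sector₁₂ : 0ℤ ≤ v₁ → 0ℤ ≤ v₂ → ShortWalk (x , y) (x′ , y′)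
  sector₁₂ h₁ h₂ = zigzag dir+x dir-y h₁ h₂ (cong₂ _,_ ex ey)
    (split (z≤z⁺ v₁) (z≤z⁺ v₂) (0≤z⁺ v₃) el) (split (0≤z⁺ w₁) (0≤z⁺ w₂) (z≤z⁺ w₃) er)
    where
    ex : x′ ≡ x + (x′ - x) * 1ℤ + (- y′ - - y) * 0ℤ
    ex = solve (x ∷ y ∷ x′ ∷ y′ ∷ [])
    ey : y′ ≡ y + (x′ - x) * 0ℤ + (- y′ - - y) * -1ℤ
    ey = solve (x ∷ y ∷ x′ ∷ y′ ∷ [])
    el : (x′ - x) + (- y′ - - y) ≡ (x′ - x) + (- y′ - - y) + 0ℤ
    el = solve (x ∷ y ∷ x′ ∷ y′ ∷ [])
    er : (x′ - x) + (- y′ - - y) ≡ 0ℤ + 0ℤ + ((y - x) - (y′ - x′))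
    er = solve (x ∷ y ∷ x′ ∷ y′ ∷ [])

  sector₁₃ : 0ℤ ≤ v₁ → 0ℤ ≤ v₃ → ShortWalk (x , y) (x′ , y′)
  sector₁₃ h₁ h₃ = zigzag dir+xy dir+y h₁ h₃ (cong₂ _,_ ex ey)
    (split (z≤z⁺ v₁) (0≤z⁺ v₂) (z≤z⁺ v₃) el) (split (0≤z⁺ w₁) (z≤z⁺ w₂) (0≤z⁺ w₃) er)
    where
    ex : x′ ≡ x + (x′ - x) * 1ℤ + ((y′ - x′) - (y - x)) * 0ℤ
    ex = solve (x ∷ y ∷ x′ ∷ y′ ∷ [])
    ey : y′ ≡ y + (x′ - x) * 1ℤ + ((y′ - x′) - (y - x)) * 1ℤ
    ey = solve (x ∷ y ∷ x′ ∷ y′ ∷ [])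
    el : (x′ - x) + ((y′ - x′) - (y - x)) ≡ (x′ - x) + 0ℤ + ((y′ - x′) - (y - x))
    el = solve (x ∷ y ∷ x′ ∷ y′ ∷ [])
    er : (x′ - x) + ((y′ - x′) - (y - x)) ≡ 0ℤ + (- y - - y′) + 0ℤ
    er = solve (x ∷ y ∷ x′ ∷ y′ ∷ [])

  sector₂₃ : 0ℤ ≤ v₂ → 0ℤ ≤ v₃ → ShortWalk (x , y) (x′ , y′)
  sector₂₃ h₂ h₃ = zigzag dir-xy dir-x h₂ h₃ (cong₂ _,_ ex ey)
    (split (0≤z⁺ v₁) (z≤z⁺ v₂) (z≤z⁺ v₃) el) (split (z≤z⁺ w₁) (0≤z⁺ w₂) (0≤z⁺ w₃) er)
    where
    ex : x′ ≡ x + (- y′ - - y) * -1ℤ + ((y′ - x′) - (y - x)) * -1ℤ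
    ex = solve (x ∷ y ∷ x′ ∷ y′ ∷ [])
    ey : y′ ≡ y + (- y′ - - y) * -1ℤ + ((y′ - x′) - (y - x)) * 0ℤ
    ey = solve (x ∷ y ∷ x′ ∷ y′ ∷ [])
    el : (- y′ - - y) + ((y′ - x′) - (y - x)) ≡ 0ℤ + (- y′ - - y) + ((y′ - x′) - (y - x))
    el = solve (x ∷ y ∷ x′ ∷ y′ ∷ [])
    er : (- y′ - - y) + ((y′ - x′) - (y - x)) ≡ (x - x′) + 0ℤ + 0ℤ
    er = solve (x ∷ y ∷ x′ ∷ y′ ∷ [])

-- Among the signs of three differences two agree. If both are nonnegative, a sector applies
-- directly; if both are nonpositive, it applies to the reversed walk.
short-walk : ∀ u w → ShortWalk u w
short-walk u@(x , y) w@(x′ , y′) =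
  go (≤-total (f₁ u) (f₁ w)) (≤-total (f₂ u) (f₂ w)) (≤-total (f₃ u) (f₃ w))
  where
  go : f₁ u ≤ f₁ w ⊎ f₁ w ≤ f₁ u → f₂ u ≤ f₂ w ⊎ f₂ w ≤ f₂ u → f₃ u ≤ f₃ w ⊎ f₃ w ≤ f₃ u → ShortWalk u w
  go (inj₁ h₁) (inj₁ h₂) _         = sector₁₂ x y x′ y′ (i≤j⇒0≤j-i h₁) (i≤j⇒0≤j-i h₂)
  go (inj₂ h₁) (inj₂ h₂) _         = short-walk-sym (sector₁₂ x′ y′ x y (i≤j⇒0≤j-i h₁) (i≤j⇒0≤j-i h₂))
  go (inj₁ h₁) (inj₂ _)  (inj₁ h₃) = sector₁₃ x y x′ y′ (i≤j⇒0≤j-i h₁) (i≤j⇒0≤j-i h₃)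
  go (inj₁ _)  (inj₂ h₂) (inj₂ h₃) = short-walk-sym (sector₂₃ x′ y′ x y (i≤j⇒0≤j-i h₂) (i≤j⇒0≤j-i h₃))
  go (inj₂ _)  (inj₁ h₂) (inj₁ h₃) = sector₂₃ x y x′ y′ (i≤j⇒0≤j-i h₂) (i≤j⇒0≤j-i h₃)
  go (inj₂ h₁) (inj₁ _)  (inj₂ h₃) = short-walk-sym (sector₁₃ x′ y′ x y (i≤j⇒0≤j-i h₁) (i≤j⇒0≤j-i h₃))

-- Trees spanned by walks.

_≟ₚ_ : DecidableEquality Point
_≟ₚ_ = ≡-dec ℤ._≟_ ℤ._≟_

open import Data.List.Membership.DecPropositional _≟ₚ_ using (_∈?_)

Extension : List Point → ℕ → Point → ℕ → Set
Extension vs k w n = ∃[ vs′ ] ∃[ k′ ] Tree vs′ k′ × vs ⊆ vs′ × w ∈ vs′ × k′ ℕ.≤ n ℕ.+ k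

-- A walk may run back into the tree, whereas `grow` accepts new vertices only. Such a step costs no
-- edge, so the edge count is bounded rather than determined.
extend : ∀ {vs k u w n} → Tree vs k → u ∈ vs → Walk u w n → Extension vs k w n
extend t u∈ [] = _ , _ , t , id , u∈ , ℕ.≤-refl
extend {vs} {k} {n = suc n} t u∈ (_∷_ {v = v} e p) with v ∈? vs
... | yes v∈ =
  let vs′ , k′ , t′ , vs⊆ , w∈ , k′≤ = extend t v∈ p
  in vs′ , k′ , t′ , vs⊆ , w∈ , ℕ.m≤n⇒m≤1+n k′≤
... | no v∉ =
  let vs′ , k′ , t′ , vs⊆ , w∈ , k′≤ = extend (grow t u∈ v∉ e) (here refl) p
  in vs′ , k′ , t′ , vs⊆ ∘ there , w∈ , ℕ.≤-trans k′≤ (ℕ.≤-reflexive (ℕ.+-suc n k))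

star : ∀ {m p q r i j k d} → Walk m p i → Walk m q j → Walk m r k → i ℕ.+ j ℕ.+ k ℕ.≤ d →
       TristanceAtMost p q r d
star {m} {i = i} {j} {k} wp wq wr total≤ =
  let vs₁ , k₁ , t₁ , s₁ , p∈ , b₁ = extend (single m) (here refl) wp
      vs₂ , k₂ , t₂ , s₂ , q∈ , b₂ = extend t₁ (s₁ (here refl)) wq
      vs₃ , k₃ , t₃ , s₃ , r∈ , b₃ = extend t₂ (s₂ (s₁ (here refl))) wr
  in vs₃ , k₃ , t₃ , s₃ (s₂ p∈) , s₃ q∈ , r∈ , (begin
    k₃                             ≤⟨ b₃ ⟩
    k ℕ.+ k₂                       ≤⟨ ℕ.+-monoʳ-≤ k b₂ ⟩
    k ℕ.+ (j ℕ.+ k₁)               ≤⟨ ℕ.+-monoʳ-≤ k (ℕ.+-monoʳ-≤ j b₁) ⟩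
    k ℕ.+ (j ℕ.+ (i ℕ.+ 0))        ≡⟨ cong (λ z → k ℕ.+ (j ℕ.+ z)) (ℕ.+-identityʳ i) ⟩
    k ℕ.+ (j ℕ.+ i)                ≡⟨ cong (k ℕ.+_) (ℕ.+-comm j i) ⟩
    k ℕ.+ (i ℕ.+ j)                ≡⟨ ℕ.+-comm k (i ℕ.+ j) ⟩
    i ℕ.+ j ℕ.+ k                  ≤⟨ total≤ ⟩
    _                              ∎)
  where open ℕ.≤-Reasoning

-- Medians and Steiner points.

deficit surplus : ℤ → ℤ → ℤ → ℤ → ℤ
deficit m a b c = (m - a) ⁺ + (m - b) ⁺ + (m - c) ⁺
surplus m a b c = (a - m) ⁺ + (b - m) ⁺ + (c - m) ⁺

-- Records what is used of the middle value `e`: at or below it only the smallest of the three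
-- values can lie under `m`, at or above it only the largest can lie over `m`. Both bounds are
-- symmetric in `a`, `b`, `c`, so the sorted case yields all others by swaps.
Median : ℤ → ℤ → ℤ → ℤ → ℤ → Set
Median n M a b c = ∃[ e ] n ≤ e × e ≤ M
  × (∀ {m} → n ≤ m → m ≤ e → deficit m a b c ≤ m - n)
  × (∀ {m} → e ≤ m → m ≤ M → surplus m a b c ≤ M - m)

median : ∀ {n M} a b c → n ≤ a → a ≤ M → n ≤ b → b ≤ M → n ≤ c → c ≤ M → Median n M a b c
median {n} {M} = λ a b c n≤a a≤M n≤b b≤M n≤c c≤M →
  sort a b c n≤a a≤M n≤b b≤M n≤c c≤M (≤-total a b) (≤-total b c) (≤-total a c)
  where
  vanish : ∀ {x y} → x ≤ y → (x - y) ⁺ ≤ 0ℤ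
  vanish x≤y = ⊔-lub (i≤j⇒i-j≤0 x≤y) ≤-refl

  sorted : ∀ a b c → a ≤ b → b ≤ c → n ≤ a → c ≤ M → Median n M a b c
  sorted a b c a≤b b≤c n≤a c≤M = b , ≤-trans n≤a a≤b , ≤-trans b≤c c≤M ,
    (λ {m} n≤m m≤b → subst (_ ≤_) (r₀ (m - n))
       (⊔-lub (+-monoʳ-≤ m (neg-mono-≤ n≤a)) (i≤j⇒0≤j-i n≤m)
         ⊕ vanish m≤b ⊕ vanish (≤-trans m≤b b≤c))) ,
    (λ {m} b≤m m≤M → subst (_ ≤_) (r₁ (M - m))
       (vanish (≤-trans a≤b b≤m) ⊕ vanish b≤m
         ⊕ ⊔-lub (+-monoˡ-≤ (- m) c≤M) (i≤j⇒0≤j-i m≤M)))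
    where
    r₀ : ∀ z → z + 0ℤ + 0ℤ ≡ z
    r₀ = solve-∀
    r₁ : ∀ z → 0ℤ + 0ℤ + z ≡ z
    r₁ = solve-∀

  swap₁₂ : ∀ {a b c} → Median n M a b c → Median n M b a c
  swap₁₂ {a} {b} {c} (e , n≤e , e≤M , h , h′) = e , n≤e , e≤M ,
    (λ {m} p q → subst (_≤ _) (cong (_+ (m - c) ⁺) (+-comm ((m - a) ⁺) _)) (h p q)) ,
    (λ {m} p q → subst (_≤ _) (cong (_+ (c - m) ⁺) (+-comm ((a - m) ⁺) _)) (h′ p q))

  swap₂₃ : ∀ {a b c} → Median n M a b c → Median n M a c b
  swap₂₃ {a} {b} {c} (e , n≤e , e≤M , h , h′) = e , n≤e , e≤M ,
    (λ {m} p q → subst (_≤ _) (acb ((m - a) ⁺) ((m - b) ⁺) ((m - c) ⁺)) (h p q)) ,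
    (λ {m} p q → subst (_≤ _) (acb ((a - m) ⁺) ((b - m) ⁺) ((c - m) ⁺)) (h′ p q))
    where
    acb : ∀ x y z → x + y + z ≡ x + z + y
    acb = solve-∀

  sort : ∀ a b c → n ≤ a → a ≤ M → n ≤ b → b ≤ M → n ≤ c → c ≤ M →
         a ≤ b ⊎ b ≤ a → b ≤ c ⊎ c ≤ b → a ≤ c ⊎ c ≤ a → Median n M a b c
  sort a b c n≤a a≤M n≤b b≤M n≤c c≤M = λ where
    (inj₁ a≤b) (inj₁ b≤c) _          → sorted a b c a≤b b≤c n≤a c≤M
    (inj₁ a≤b) (inj₂ c≤b) (inj₁ a≤c) → swap₂₃ (sorted a c b a≤c c≤b n≤a b≤M)
    (inj₁ a≤b) (inj₂ c≤b) (inj₂ c≤a) → swap₂₃ (swap₁₂ (sorted c a b c≤a a≤b n≤c b≤M))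
    (inj₂ b≤a) (inj₁ b≤c) (inj₁ a≤c) → swap₁₂ (sorted b a c b≤a a≤c n≤b c≤M)
    (inj₂ b≤a) (inj₁ b≤c) (inj₂ c≤a) → swap₁₂ (swap₂₃ (sorted b c a b≤c c≤a n≤b a≤M))
    (inj₂ b≤a) (inj₂ c≤b) _          →
      swap₁₂ (swap₂₃ (swap₁₂ (sorted c b a c≤b b≤a n≤c a≤M)))

-- Starting from the upper bounds, the coordinates are lowered greedily, one
-- after the other, until the sum is 0.
balanced-point : ∀ l₁ l₂ l₃ h₁ h₂ h₃ → l₁ ≤ h₁ → l₂ ≤ h₂ → l₃ ≤ h₃ →
  l₁ + l₂ + l₃ ≤ 0ℤ → 0ℤ ≤ h₁ + h₂ + h₃ →
  ∃[ m ] (l₁ ≤ f₁ m × f₁ m ≤ h₁) × (l₂ ≤ f₂ m × f₂ m ≤ h₂) × (l₃ ≤ f₃ m × f₃ m ≤ h₃)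
balanced-point l₁ l₂ l₃ h₁ h₂ h₃ b₁ b₂ b₃ l≤0 0≤h = go (≤-total l₁ (- h₂ - h₃)) (≤-total l₂ (- l₁ - h₃))
  where
  Result : Set
  Result = ∃[ m ] (l₁ ≤ f₁ m × f₁ m ≤ h₁) × (l₂ ≤ f₂ m × f₂ m ≤ h₂) × (l₃ ≤ f₃ m × f₃ m ≤ h₃)

  point : ∀ m₁ m₂ → l₁ ≤ m₁ → m₁ ≤ h₁ → l₂ ≤ m₂ → m₂ ≤ h₂ → l₃ ≤ - m₂ - m₁ → - m₂ - m₁ ≤ h₃ → Result
  point m₁ m₂ a b c d e f = (m₁ , - m₂) , (a , b) ,
    (subst (l₂ ≤_) (sym (neg-involutive m₂)) c , subst (_≤ h₂) (sym (neg-involutive m₂)) d) , e , f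

  go : l₁ ≤ - h₂ - h₃ ⊎ - h₂ - h₃ ≤ l₁ → l₂ ≤ - l₁ - h₃ ⊎ - l₁ - h₃ ≤ l₂ → Result
  go (inj₁ l₁≤) _ = point (- h₂ - h₃) h₂ l₁≤
    (linear 0≤h (solve (h₁ ∷ h₂ ∷ h₃ ∷ []))) b₂ ≤-refl
    (linear b₃ (solve (l₃ ∷ h₂ ∷ h₃ ∷ []))) (eq≤ (solve (h₂ ∷ h₃ ∷ [])))
  go (inj₂ ≤l₁) (inj₁ l₂≤) = point l₁ (- l₁ - h₃) ≤-refl b₁ l₂≤
    (linear ≤l₁ (solve (l₁ ∷ h₂ ∷ h₃ ∷ [])))
    (linear b₃ (solve (l₁ ∷ l₃ ∷ h₃ ∷ []))) (eq≤ (solve (l₁ ∷ h₃ ∷ [])))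
  go (inj₂ ≤l₁) (inj₂ ≤l₂) = point l₁ l₂ ≤-refl b₁ ≤-refl b₂
    (linear l≤0 (solve (l₁ ∷ l₂ ∷ l₃ ∷ [])))
    (linear ≤l₂ (solve (l₁ ∷ l₂ ∷ h₃ ∷ [])))

record Hexagon : Set where
  constructor hexagon
  field n₁ n₂ n₃ M₁ M₂ M₃ : ℤ

infix 4 _∈ₕ_
_∈ₕ_ : Point → Hexagon → Set
p ∈ₕ hexagon n₁ n₂ n₃ M₁ M₂ M₃ =
  (n₁ ≤ f₁ p × f₁ p ≤ M₁) × (n₂ ≤ f₂ p × f₂ p ≤ M₂) × (n₃ ≤ f₃ p × f₃ p ≤ M₃)

upSize downSize : Hexagon → ℤ
upSize   (hexagon n₁ n₂ n₃ M₁ M₂ M₃) = M₁ + M₂ + M₃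
downSize (hexagon n₁ n₂ n₃ M₁ M₂ M₃) = - (n₁ + n₂ + n₃)

-- A Steiner point m is taken with every fᵢ m between the median of fᵢ over
-- p, q, r and nᵢ (or Mᵢ), depending on the sign of the sum of the medians.
-- Then only one of the three points contributes to each coordinate deficit.
hexagon-tristance : ∀ {d p q r} H → upSize H ≤ + d → downSize H ≤ + d →
  p ∈ₕ H → q ∈ₕ H → r ∈ₕ H → TristanceAtMost p q r d
hexagon-tristance {d} {p} {q} {r} (hexagon n₁ n₂ n₃ M₁ M₂ M₃) up≤ down≤
  ((p₁ , p₁′) , (p₂ , p₂′) , (p₃ , p₃′)) ((q₁ , q₁′) , (q₂ , q₂′) , (q₃ , q₃′))
  ((r₁ , r₁′) , (r₂ , r₂′) , (r₃ , r₃′))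
  with median (f₁ p) (f₁ q) (f₁ r) p₁ p₁′ q₁ q₁′ r₁ r₁′
     | median (f₂ p) (f₂ q) (f₂ r) p₂ p₂′ q₂ q₂′ r₂ r₂′
     | median (f₃ p) (f₃ q) (f₃ r) p₃ p₃′ q₃ q₃′ r₃ r₃′
... | e₁ , n≤e₁ , e≤M₁ , def₁ , sur₁ | e₂ , n≤e₂ , e≤M₂ , def₂ , sur₂
    | e₃ , n≤e₃ , e≤M₃ , def₃ , sur₃ = go (≤-total 0ℤ (e₁ + e₂ + e₃))
  where
  n≤0 : n₁ + n₂ + n₃ ≤ 0ℤ
  n≤0 = subst (n₁ + n₂ + n₃ ≤_) (f-sum p) (p₁ ⊕ p₂ ⊕ p₃)

  0≤M : 0ℤ ≤ M₁ + M₂ + M₃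
  0≤M = subst (_≤ M₁ + M₂ + M₃) (f-sum p) (p₁′ ⊕ p₂′ ⊕ p₃′)

  rows→columns : ∀ (g₁ g₂ g₃ : Point → ℤ) →
    (g₁ p ⁺ + g₂ p ⁺ + g₃ p ⁺) + (g₁ q ⁺ + g₂ q ⁺ + g₃ q ⁺) + (g₁ r ⁺ + g₂ r ⁺ + g₃ r ⁺)
    ≡ (g₁ p ⁺ + g₁ q ⁺ + g₁ r ⁺) + (g₂ p ⁺ + g₂ q ⁺ + g₂ r ⁺) + (g₃ p ⁺ + g₃ q ⁺ + g₃ r ⁺)
  rows→columns g₁ g₂ g₃ = transpose (g₁ p ⁺) (g₂ p ⁺) (g₃ p ⁺) (g₁ q ⁺) (g₂ q ⁺) (g₃ q ⁺)
                                    (g₁ r ⁺) (g₂ r ⁺) (g₃ r ⁺)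
    where
    transpose : ∀ a b c d e f g h i → (a + b + c) + (d + e + f) + (g + h + i)
                                    ≡ (a + d + g) + (b + e + h) + (c + f + i)
    transpose = solve-∀

  drop-f : ∀ a b c x y z → a + b + c ≡ 0ℤ → (a - x) + (b - y) + (c - z) ≡ - (x + y + z)
  drop-f a b c x y z eq = trans (e a b c x y z) (trans (cong (_- (x + y + z)) eq) (+-identityˡ _))
    where
    e : ∀ a b c x y z → (a - x) + (b - y) + (c - z) ≡ (a + b + c) - (x + y + z)
    e = solve-∀

  drop-f′ : ∀ a b c x y z → a + b + c ≡ 0ℤ → (x - a) + (y - b) + (z - c) ≡ x + y + z
  drop-f′ a b c x y z eq = trans (e a b c x y z) (trans (cong (λ s → x + y + z - s) eq) (+-identityʳ _))
    where
    e : ∀ a b c x y z → (x - a) + (y - b) + (z - c) ≡ (x + y + z) - (a + b + c)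
    e = solve-∀

  -- The minima sum to at most 0 and the maxima to at least 0, so a point of sum 0 fits between the
  -- medians and the extremes on the other side of 0. Its own coordinates cancel from the summed
  -- bounds, which leaves one of the two triangle sides.
  go : 0ℤ ≤ e₁ + e₂ + e₃ ⊎ e₁ + e₂ + e₃ ≤ 0ℤ → TristanceAtMost p q r d
  go (inj₁ 0≤e) =
    let m , (l₁ , h₁) , (l₂ , h₂) , (l₃ , h₃) =
          balanced-point n₁ n₂ n₃ e₁ e₂ e₃ n≤e₁ n≤e₂ n≤e₃ n≤0 0≤e
        i , wp , _ , bp = short-walk m p
        j , wq , _ , bq = short-walk m q
        k , wr , _ , br = short-walk m r
    in star wp wq wr (drop‿+≤+ (begin
      + i + + j + + k                                   ≤⟨ bp ⊕ bq ⊕ br ⟩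
      excess p m + excess q m + excess r m
        ≡⟨ rows→columns (λ s → f₁ m - f₁ s) (λ s → f₂ m - f₂ s) (λ s → f₃ m - f₃ s) ⟩
      deficit (f₁ m) (f₁ p) (f₁ q) (f₁ r)
        + deficit (f₂ m) (f₂ p) (f₂ q) (f₂ r)
        + deficit (f₃ m) (f₃ p) (f₃ q) (f₃ r)
        ≤⟨ def₁ {f₁ m} l₁ h₁ ⊕ def₂ {f₂ m} l₂ h₂ ⊕ def₃ {f₃ m} l₃ h₃ ⟩
      (f₁ m - n₁) + (f₂ m - n₂) + (f₃ m - n₃)
        ≡⟨ drop-f (f₁ m) (f₂ m) (f₃ m) n₁ n₂ n₃ (f-sum m) ⟩
      - (n₁ + n₂ + n₃)                                  ≤⟨ down≤ ⟩
      + d                                               ∎))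
    where open ≤-Reasoning
  go (inj₂ e≤0) =
    let m , (l₁ , h₁) , (l₂ , h₂) , (l₃ , h₃) =
          balanced-point e₁ e₂ e₃ M₁ M₂ M₃ e≤M₁ e≤M₂ e≤M₃ e≤0 0≤M
        i , wp , bp , _ = short-walk m p
        j , wq , bq , _ = short-walk m q
        k , wr , br , _ = short-walk m r
    in star wp wq wr (drop‿+≤+ (begin
      + i + + j + + k                                   ≤⟨ bp ⊕ bq ⊕ br ⟩
      excess m p + excess m q + excess m r
        ≡⟨ rows→columns (λ s → f₁ s - f₁ m) (λ s → f₂ s - f₂ m) (λ s → f₃ s - f₃ m) ⟩
      surplus (f₁ m) (f₁ p) (f₁ q) (f₁ r)
        + surplus (f₂ m) (f₂ p) (f₂ q) (f₂ r)
        + surplus (f₃ m) (f₃ p) (f₃ q) (f₃ r)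
        ≤⟨ sur₁ {f₁ m} l₁ h₁ ⊕ sur₂ {f₂ m} l₂ h₂ ⊕ sur₃ {f₃ m} l₃ h₃ ⟩
      (M₁ - f₁ m) + (M₂ - f₂ m) + (M₃ - f₃ m)
        ≡⟨ drop-f′ (f₁ m) (f₂ m) (f₃ m) M₁ M₂ M₃ (f-sum m) ⟩
      M₁ + M₂ + M₃                                      ≤⟨ up≤ ⟩
      + d                                               ∎))
    where open ≤-Reasoning

-- Counting points in triangles and truncated triangles.

length-⊆ : ∀ {A : Set} {xs ys : List A} → Unique xs → xs ⊆ ys → length xs ℕ.≤ length ys
length-⊆ {xs = []} _ _ = z≤n
length-⊆ {xs = x ∷ xs} {ys} (x∉ ∷ unique) xs⊆ with ∈-∃++ (xs⊆ (here refl))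
... | as , bs , refl = begin
  suc (length xs)                    ≤⟨ s≤s (length-⊆ unique rest⊆) ⟩
  suc (length (as ++ bs))            ≡⟨ cong suc (length-++ as) ⟩
  suc (length as ℕ.+ length bs)      ≡⟨ ℕ.+-suc (length as) (length bs) ⟨
  length as ℕ.+ length (x ∷ bs)      ≡⟨ length-++ as ⟨
  length (as ++ x ∷ bs)              ∎
  where
  open ℕ.≤-Reasoning
  rest⊆ : xs ⊆ as ++ bs
  rest⊆ v∈ with ∈-++⁻ as (xs⊆ (there v∈))
  ... | inj₁ v∈as          = ∈-++⁺ˡ v∈as
  ... | inj₂ (here refl)   = contradiction refl (All.lookup x∉ v∈)
  ... | inj₂ (there v∈bs)  = ∈-++⁺ʳ as v∈bs

grid : ℕ → List (ℕ × ℕ)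
grid zero    = []
grid (suc n) = map (_, 0) (upTo (suc n)) ++ map (map₂ suc) (grid n)

length-grid : ∀ n → 2 ℕ.* length (grid n) ≡ n ℕ.* suc n
length-grid zero    = refl
length-grid (suc n) = begin
  2 ℕ.* length (grid (suc n))
    ≡⟨ cong (2 ℕ.*_) (length-++ row) ⟩
  2 ℕ.* (length row ℕ.+ length rest)
    ≡⟨ cong₂ (λ a b → 2 ℕ.* (a ℕ.+ b))
         (trans (length-map (_, 0) (upTo (suc n))) (length-upTo (suc n)))
         (length-map (map₂ suc) (grid n)) ⟩
  2 ℕ.* (suc n ℕ.+ length (grid n))
    ≡⟨ ℕ.*-distribˡ-+ 2 (suc n) (length (grid n)) ⟩
  2 ℕ.* suc n ℕ.+ 2 ℕ.* length (grid n)
    ≡⟨ cong (2 ℕ.* suc n ℕ.+_) (length-grid n) ⟩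
  2 ℕ.* suc n ℕ.+ n ℕ.* suc n
    ≡⟨ eq n ⟩
  suc n ℕ.* suc (suc n) ∎
  where
  open ≡-Reasoning
  row rest : List (ℕ × ℕ)
  row = map (_, 0) (upTo (suc n))
  rest = map (map₂ suc) (grid n)
  eq : ∀ n → 2 ℕ.* (1 ℕ.+ n) ℕ.+ n ℕ.* (1 ℕ.+ n) ≡ (1 ℕ.+ n) ℕ.* (1 ℕ.+ (1 ℕ.+ n))
  eq = ℕR.solve-∀

∈-grid⁺ : ∀ {n} i j → i ℕ.+ j ℕ.< n → (i , j) ∈ grid n
∈-grid⁺ {suc n} i zero i+0<n =
  ∈-++⁺ˡ (∈-map⁺ (_, 0) (∈-upTo⁺ (subst (ℕ._< suc n) (ℕ.+-identityʳ i) i+0<n)))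
∈-grid⁺ {suc n} i (suc j) i+j<n = ∈-++⁺ʳ (map (_, 0) (upTo (suc n)))
  (∈-map⁺ (map₂ suc) (∈-grid⁺ i j (ℕ.s≤s⁻¹ (subst (ℕ._< suc n) (ℕ.+-suc i j) i+j<n))))

∈-grid⁻ : ∀ {n i j} → (i , j) ∈ grid n → i ℕ.+ j ℕ.< n
∈-grid⁻ {suc n} ij∈ with ∈-++⁻ (map (_, 0) (upTo (suc n))) ij∈
... | inj₁ ij∈ˡ with ∈-map⁻ (_, 0) ij∈ˡ
...   | i , i∈ , refl = subst (ℕ._< suc n) (sym (ℕ.+-identityʳ i)) (∈-upTo⁻ i∈)
∈-grid⁻ {suc n} ij∈ | inj₂ ij∈ʳ with ∈-map⁻ (map₂ suc) ij∈ʳ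
...   | (i , j) , ij∈′ , refl = subst (ℕ._< suc n) (sym (ℕ.+-suc i j)) (s≤s (∈-grid⁻ ij∈′))

grid-unique : ∀ n → Unique (grid n)
grid-unique zero    = []
grid-unique (suc n) = Unique.++⁺
  (Unique.map⁺ (λ { refl → refl }) (Unique.upTo⁺ (suc n)))
  (Unique.map⁺ (λ { refl → refl }) (grid-unique n))
  disjoint
  where
  disjoint : Disjoint (map (_, 0) (upTo (suc n))) (map (map₂ suc) (grid n))
  disjoint (v∈ , v∈′) with ∈-map⁻ (_, 0) v∈ | ∈-map⁻ (map₂ suc) v∈′
  ... | _ , _ , refl | _ , _ , ()

-- `i` and `j` are the amounts by which `f₁` and `f₂` fall short of `m₁` and `m₂`. As the three
-- coordinates sum to 0, an upper bound on `f₃` becomes an upper bound on `i + j`.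
place : ℤ → ℤ → ℕ × ℕ → Point
place m₁ m₂ (i , j) = m₁ - + i , + j - m₂

-- The points with f₁ ≤ m₁, f₂ ≤ m₂ and f₃ ≤ n - 1 - m₁ - m₂.
triangle : ℤ → ℤ → ℕ → List Point
triangle m₁ m₂ n = map (place m₁ m₂) (grid n)

length-triangle : ∀ m₁ m₂ n → 2 ℕ.* length (triangle m₁ m₂ n) ≡ n ℕ.* suc n
length-triangle m₁ m₂ n = trans (cong (2 ℕ.*_) (length-map (place m₁ m₂) (grid n))) (length-grid n)

triangle-unique : ∀ m₁ m₂ n → Unique (triangle m₁ m₂ n)
triangle-unique m₁ m₂ n = Unique.map⁺ injective (grid-unique n)
  where
  injective : ∀ {a b} → place m₁ m₂ a ≡ place m₁ m₂ b → a ≡ b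
  injective {i , j} {i′ , j′} eq = cong₂ _,_
    (+-injective (neg-injective (+-cancelˡ m₁ _ _ (cong proj₁ eq))))
    (+-injective (+-cancelʳ (- m₂) _ _ (cong proj₂ eq)))

Below : ℤ → ℤ → ℤ → Point → Set
Below m₁ m₂ m₃ p = f₁ p ≤ m₁ × f₂ p ≤ m₂ × f₃ p ≤ m₃

∈-triangle⁺ : ∀ {m₁ m₂ m₃ n p} → 1ℤ + (m₁ + m₂ + m₃) ≡ + n → Below m₁ m₂ m₃ p → p ∈ triangle m₁ m₂ n
∈-triangle⁺ {m₁} {m₂} {m₃} {n} {x , y} size (b₁ , b₂ , b₃) =
  subst (_∈ triangle m₁ m₂ n) placed (∈-map⁺ (place m₁ m₂) (∈-grid⁺ i j (drop‿+≤+ i+j<n)))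
  where
  i j : ℕ
  i = ∣ m₁ - x ∣
  j = ∣ m₂ - - y ∣
  i≡ : + i ≡ m₁ - x
  i≡ = 0≤i⇒+∣i∣≡i (i≤j⇒0≤j-i b₁)
  j≡ : + j ≡ m₂ - - y
  j≡ = 0≤i⇒+∣i∣≡i (i≤j⇒0≤j-i b₂)
  placed : (m₁ - + i , + j - m₂) ≡ (x , y)
  placed = cong₂ _,_
    (trans (cong (λ a → m₁ - a) i≡) (solve (m₁ ∷ x ∷ [])))
    (trans (cong (λ b → b - m₂) j≡) (solve (m₂ ∷ y ∷ [])))
  y-x≤m₃ : y - x ≤ m₃
  y-x≤m₃ = b₃
  ineq : 1ℤ + ((m₁ - x) + (m₂ - - y)) ≤ 1ℤ + (m₁ + m₂ + m₃)
  ineq = linear y-x≤m₃ (solve (m₁ ∷ m₂ ∷ m₃ ∷ x ∷ y ∷ []))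
  i+j<n : 1ℤ + (+ i + + j) ≤ + n
  i+j<n = subst₂ _≤_ (cong₂ (λ a b → 1ℤ + (a + b)) (sym i≡) (sym j≡)) size ineq

∈-triangle⁻ : ∀ {m₁ m₂ m₃ n p} → 1ℤ + (m₁ + m₂ + m₃) ≡ + n → p ∈ triangle m₁ m₂ n → Below m₁ m₂ m₃ p
∈-triangle⁻ {m₁} {m₂} {m₃} {n} size p∈ with ∈-map⁻ (place m₁ m₂) p∈
... | (i , j) , ij∈ , refl =
  b₁ (+ i) (+≤+ z≤n) , b₂ (+ j) (+≤+ z≤n) ,
  b₃ (+ i) (+ j) (subst (1ℤ + (+ i + + j) ≤_) (sym size) (+≤+ (∈-grid⁻ ij∈)))
  where
  b₁ : ∀ i → 0ℤ ≤ i → m₁ - i ≤ m₁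
  b₁ i h = linear h (solve (m₁ ∷ i ∷ []))
  b₂ : ∀ j → 0ℤ ≤ j → - (j - m₂) ≤ m₂
  b₂ j h = linear h (solve (m₂ ∷ j ∷ []))
  b₃ : ∀ i j → 1ℤ + (i + j) ≤ 1ℤ + (m₁ + m₂ + m₃) → (j - m₂) - (m₁ - i) ≤ m₃
  b₃ i j h = linear h (solve (m₁ ∷ m₂ ∷ m₃ ∷ i ∷ j ∷ []))

∈ₕ? : ∀ H p → Dec (p ∈ₕ H)
∈ₕ? (hexagon n₁ n₂ n₃ M₁ M₂ M₃) p =
  ((n₁ ≤? f₁ p) ×-dec (f₁ p ≤? M₁)) ×-dec
  (((n₂ ≤? f₂ p) ×-dec (f₂ p ≤? M₂)) ×-dec ((n₃ ≤? f₃ p) ×-dec (f₃ p ≤? M₃)))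

-- H is the triangle fᵢ ≤ Mᵢ of side s with three corner triangles cut off,
-- the one at corner i having tᵢ points on a side.
record Truncation (H : Hexagon) (s t₁ t₂ t₃ : ℕ) : Set where
  open Hexagon H
  field
    side    : M₁ + M₂ + M₃ ≡ + s
    corner₁ : n₁ + M₂ + M₃ ≡ + t₁
    corner₂ : M₁ + n₂ + M₃ ≡ + t₂
    corner₃ : M₁ + M₂ + n₃ ≡ + t₃

module Counting {H s t₁ t₂ t₃} (T : Truncation H s t₁ t₂ t₃) where
  open Hexagon H
  open Truncation T

  big c₁ c₂ c₃ : List Point
  big = triangle M₁ M₂ (suc s)
  c₁ = triangle (n₁ - 1ℤ) M₂ t₁
  c₂ = triangle M₁ (n₂ - 1ℤ) t₂
  -- The bound `n₃ - 1` on `f₃` is implicit in the number `t₃` of points on a side, see `size₃`.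
  c₃ = triangle M₁ M₂ t₃

  private
    size : 1ℤ + (M₁ + M₂ + M₃) ≡ + suc s
    size = cong (λ z → 1ℤ + z) side

    size₁ : 1ℤ + (n₁ - 1ℤ + M₂ + M₃) ≡ + t₁
    size₁ = trans (eq n₁ M₂ M₃) corner₁
      where
      eq : ∀ a b c → 1ℤ + (a - 1ℤ + b + c) ≡ a + b + c
      eq = solve-∀

    size₂ : 1ℤ + (M₁ + (n₂ - 1ℤ) + M₃) ≡ + t₂
    size₂ = trans (eq M₁ n₂ M₃) corner₂
      where
      eq : ∀ a b c → 1ℤ + (a + (b - 1ℤ) + c) ≡ a + b + c
      eq = solve-∀

    size₃ : 1ℤ + (M₁ + M₂ + (n₃ - 1ℤ)) ≡ + t₃
    size₃ = trans (eq M₁ M₂ n₃) corner₃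
      where
      eq : ∀ a b c → 1ℤ + (a + b + (c - 1ℤ)) ≡ a + b + c
      eq = solve-∀

    pred≤ : ∀ {a b} → a ≤ b → a - 1ℤ ≤ b
    pred≤ = i≤j⇒i-k≤j 1ℤ

    ≤pred : ∀ {a b} → ¬ (b ≤ a) → a ≤ b - 1ℤ
    ≤pred {a} {b} b≰a = linear (i<j⇒suc[i]≤j (≰⇒> b≰a)) (eq a b)
      where
      eq : ∀ a b → a - (b - 1ℤ) ≡ 1ℤ + a - b
      eq = solve-∀

    1≰0 : ¬ (1ℤ ≤ 0ℤ)
    1≰0 (+≤+ ())

    clash : ∀ {a b} → b ≤ a → a ≤ b - 1ℤ → ⊥
    clash {a} {b} h₁ h₂ = 1≰0 (linear (h₁ ⊕ h₂) (eq a b))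
      where
      eq : ∀ a b → 1ℤ - 0ℤ ≡ b + a - (a + (b - 1ℤ))
      eq = solve-∀

    length-pieces : ∀ (A : List Point) → 2 ℕ.* length (A ++ c₁ ++ c₂ ++ c₃)
      ≡ 2 ℕ.* length A ℕ.+ (t₁ ℕ.* suc t₁ ℕ.+ t₂ ℕ.* suc t₂ ℕ.+ t₃ ℕ.* suc t₃)
    length-pieces A = begin
      2 ℕ.* length (A ++ c₁ ++ c₂ ++ c₃)
        ≡⟨ cong (2 ℕ.*_) (trans (length-++ A) (cong (length A ℕ.+_)
             (trans (length-++ c₁) (cong (length c₁ ℕ.+_) (length-++ c₂))))) ⟩
      2 ℕ.* (length A ℕ.+ (length c₁ ℕ.+ (length c₂ ℕ.+ length c₃)))
        ≡⟨ eq (length A) (length c₁) (length c₂) (length c₃) ⟩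
      2 ℕ.* length A ℕ.+ (2 ℕ.* length c₁ ℕ.+ 2 ℕ.* length c₂ ℕ.+ 2 ℕ.* length c₃)
        ≡⟨ cong (2 ℕ.* length A ℕ.+_) (cong₂ ℕ._+_ (cong₂ ℕ._+_
             (length-triangle (n₁ - 1ℤ) M₂ t₁) (length-triangle M₁ (n₂ - 1ℤ) t₂))
             (length-triangle M₁ M₂ t₃)) ⟩
      2 ℕ.* length A ℕ.+ (t₁ ℕ.* suc t₁ ℕ.+ t₂ ℕ.* suc t₂ ℕ.+ t₃ ℕ.* suc t₃) ∎
      where
      open ≡-Reasoning
      eq : ∀ a b c d → 2 ℕ.* (a ℕ.+ (b ℕ.+ (c ℕ.+ d))) ≡ 2 ℕ.* a ℕ.+ (2 ℕ.* b ℕ.+ 2 ℕ.* c ℕ.+ 2 ℕ.* d)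
      eq = ℕR.solve-∀

  -- A packing: `A` and the three corners are disjoint and lie in the big triangle. The inequalities
  -- `nᵢ ≤ Mᵢ` keep the corners inside it; the last three keep the corners apart, since a common
  -- point would have a negative coordinate sum.
  count≤ : ∀ {A} → Unique A → (∀ {p} → p ∈ A → p ∈ₕ H) → n₁ ≤ M₁ → n₂ ≤ M₂ → n₃ ≤ M₃ →
    n₁ + n₂ + M₃ ≤ 0ℤ → n₁ + M₂ + n₃ ≤ 0ℤ → M₁ + n₂ + n₃ ≤ 0ℤ →
    2 ℕ.* length A ℕ.+ (t₁ ℕ.* suc t₁ ℕ.+ t₂ ℕ.* suc t₂ ℕ.+ t₃ ℕ.* suc t₃) ℕ.≤ suc s ℕ.* suc (suc s)
  count≤ {A} unique A⊆H n≤M₁ n≤M₂ n≤M₃ d₁₂ d₁₃ d₂₃ =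
    subst₂ ℕ._≤_ (length-pieces A) (length-triangle M₁ M₂ (suc s))
      (ℕ.*-monoʳ-≤ 2 (length-⊆ pieces-unique pieces⊆big))
    where
    in₁ : ∀ {p} → p ∈ c₁ → Below (n₁ - 1ℤ) M₂ M₃ p
    in₁ = ∈-triangle⁻ size₁
    in₂ : ∀ {p} → p ∈ c₂ → Below M₁ (n₂ - 1ℤ) M₃ p
    in₂ = ∈-triangle⁻ size₂
    in₃ : ∀ {p} → p ∈ c₃ → Below M₁ M₂ (n₃ - 1ℤ) p
    in₃ = ∈-triangle⁻ size₃

    overfull : ∀ {a b c} p → f₁ p ≤ a → f₂ p ≤ b → f₃ p ≤ c → a + b + c + 1ℤ ≤ 0ℤ → ⊥
    overfull {a} {b} {c} p h₁ h₂ h₃ neg =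
      1≰0 (linear (h₁ ⊕ h₂ ⊕ h₃ ⊕ neg ⊕ eq≥ (f-sum p)) (eq a b c (f₁ p) (f₂ p) (f₃ p)))
      where
      eq : ∀ a b c x y z → 1ℤ - 0ℤ ≡ x + y + z + (a + b + c + 1ℤ) + 0ℤ - (a + b + c + 0ℤ + (x + y + z))
      eq = solve-∀

    tight₁₂ : ∀ a b c → a + b + c ≤ 0ℤ → (a - 1ℤ) + (b - 1ℤ) + c + 1ℤ ≤ 0ℤ
    tight₁₂ a b c h = linear (h ⊕ +≤+ (z≤n {1})) (solve (a ∷ b ∷ c ∷ []))
    tight₁₃ : ∀ a b c → a + b + c ≤ 0ℤ → (a - 1ℤ) + b + (c - 1ℤ) + 1ℤ ≤ 0ℤ
    tight₁₃ a b c h = linear (h ⊕ +≤+ (z≤n {1})) (solve (a ∷ b ∷ c ∷ []))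
    tight₂₃ : ∀ a b c → a + b + c ≤ 0ℤ → a + (b - 1ℤ) + (c - 1ℤ) + 1ℤ ≤ 0ℤ
    tight₂₃ a b c h = linear (h ⊕ +≤+ (z≤n {1})) (solve (a ∷ b ∷ c ∷ []))

    disjoint₂₃ : Disjoint c₂ c₃
    disjoint₂₃ {p} (p∈₂ , p∈₃) with in₂ p∈₂ | in₃ p∈₃
    ... | a , b , _ | _ , _ , c = overfull p a b c (tight₂₃ M₁ n₂ n₃ d₂₃)

    disjoint₁ : Disjoint c₁ (c₂ ++ c₃)
    disjoint₁ {p} (p∈₁ , p∈) with in₁ p∈₁ | ∈-++⁻ c₂ p∈
    ... | a , _ , c | inj₁ p∈₂ = overfull p a (proj₁ (proj₂ (in₂ p∈₂))) c (tight₁₂ n₁ n₂ M₃ d₁₂)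
    ... | a , b , _ | inj₂ p∈₃ = overfull p a b (proj₂ (proj₂ (in₃ p∈₃))) (tight₁₃ n₁ M₂ n₃ d₁₃)

    disjoint₀ : Disjoint A (c₁ ++ c₂ ++ c₃)
    disjoint₀ (p∈A , p∈) with A⊆H p∈A | ∈-++⁻ c₁ p∈
    ... | (h , _) , _ | inj₁ p∈₁ = clash h (proj₁ (in₁ p∈₁))
    ... | _ , (h₂ , _) , h₃ , _ | inj₂ p∈′ with ∈-++⁻ c₂ p∈′
    ...   | inj₁ p∈₂ = clash h₂ (proj₁ (proj₂ (in₂ p∈₂)))
    ...   | inj₂ p∈₃ = clash h₃ (proj₂ (proj₂ (in₃ p∈₃)))

    pieces-unique : Unique (A ++ c₁ ++ c₂ ++ c₃)
    pieces-unique = Unique.++⁺ unique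
      (Unique.++⁺ (triangle-unique (n₁ - 1ℤ) M₂ t₁)
        (Unique.++⁺ (triangle-unique M₁ (n₂ - 1ℤ) t₂) (triangle-unique M₁ M₂ t₃) disjoint₂₃)
        disjoint₁)
      disjoint₀

    pieces⊆big : A ++ c₁ ++ c₂ ++ c₃ ⊆ big
    pieces⊆big {p} p∈ = ∈-triangle⁺ size (below (∈-++⁻ A p∈))
      where
      below″ : p ∈ c₂ ⊎ p ∈ c₃ → Below M₁ M₂ M₃ p
      below″ (inj₁ p∈) = let a , b , c = in₂ p∈ in a , ≤-trans b (pred≤ n≤M₂) , c
      below″ (inj₂ p∈) = let a , b , c = in₃ p∈ in a , b , ≤-trans c (pred≤ n≤M₃)
      below′ : p ∈ c₁ ⊎ p ∈ c₂ ++ c₃ → Below M₁ M₂ M₃ p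
      below′ (inj₁ p∈) = let a , b , c = in₁ p∈ in ≤-trans a (pred≤ n≤M₁) , b , c
      below′ (inj₂ p∈) = below″ (∈-++⁻ c₂ p∈)
      below : p ∈ A ⊎ p ∈ c₁ ++ c₂ ++ c₃ → Below M₁ M₂ M₃ p
      below (inj₁ p∈) = let (_ , a) , (_ , b) , (_ , c) = A⊆H p∈ in a , b , c
      below (inj₂ p∈) = below′ (∈-++⁻ c₁ p∈)

  points : List Point
  points = filter (∈ₕ? H) big

  -- A covering: a point of the big triangle that violates a lower bound `nᵢ` lies in the
  -- corresponding corner.
  count≥ : suc s ℕ.* suc (suc s) ℕ.≤
    2 ℕ.* length points ℕ.+ (t₁ ℕ.* suc t₁ ℕ.+ t₂ ℕ.* suc t₂ ℕ.+ t₃ ℕ.* suc t₃)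
  count≥ = subst₂ ℕ._≤_ (length-triangle M₁ M₂ (suc s)) (length-pieces points)
    (ℕ.*-monoʳ-≤ 2 (length-⊆ (triangle-unique M₁ M₂ (suc s)) big⊆))
    where
    big⊆ : big ⊆ points ++ c₁ ++ c₂ ++ c₃
    big⊆ {p} p∈ with ∈-triangle⁻ size p∈ | n₁ ≤? f₁ p | n₂ ≤? f₂ p | n₃ ≤? f₃ p
    ... | a , b , c | no n≰  | _ | _ =
      ∈-++⁺ʳ points (∈-++⁺ˡ (∈-triangle⁺ size₁ (≤pred n≰ , b , c)))
    ... | a , b , c | yes _  | no n≰  | _ =
      ∈-++⁺ʳ points (∈-++⁺ʳ c₁ (∈-++⁺ˡ (∈-triangle⁺ size₂ (a , ≤pred n≰ , c))))
    ... | a , b , c | yes _  | yes _  | no n≰ =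
      ∈-++⁺ʳ points (∈-++⁺ʳ c₁ (∈-++⁺ʳ c₂ (∈-triangle⁺ size₃ (a , b , ≤pred n≰))))
    ... | a , b , c | yes h₁ | yes h₂ | yes h₃ =
      ∈-++⁺ˡ (∈-filter⁺ (∈ₕ? H) p∈ ((h₁ , a) , (h₂ , b) , (h₃ , c)))

-- Arithmetic of the corner sizes.

0≤i*i : ∀ i → 0ℤ ≤ i * i
0≤i*i (+ zero)  = +≤+ z≤n
0≤i*i (+ suc n) = +≤+ z≤n
0≤i*i -[1+ n ]  = +≤+ z≤n

0≤i*j : ∀ {i j} → 0ℤ ≤ i → 0ℤ ≤ j → 0ℤ ≤ i * j
0≤i*j {+ m} {+ n} _ _ = subst (0ℤ ≤_) (pos-* m n) (+≤+ z≤n)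

i*i≤2⇒i≤1 : ∀ i → i * i ≤ + 2 → i ≤ 1ℤ
i*i≤2⇒i≤1 -[1+ n ] _ = -≤+
i*i≤2⇒i≤1 (+ 0)    _ = +≤+ z≤n
i*i≤2⇒i≤1 (+ 1)    _ = ≤-refl
i*i≤2⇒i≤1 (+ suc (suc n)) h
  with ℕ.≤-trans (ℕ.*-mono-≤ {2} {suc (suc n)} {2} (s≤s (s≤s z≤n)) (s≤s (s≤s z≤n))) (drop‿+≤+ h)
... | s≤s (s≤s ())

3i≤2⇒i≤0 : ∀ i → + 3 * i ≤ + 2 → i ≤ 0ℤ
3i≤2⇒i≤0 (+ zero)  _ = ≤-refl
3i≤2⇒i≤0 (+ suc n) h with ℕ.≤-trans (ℕ.*-monoʳ-≤ 3 {1} {suc n} (s≤s z≤n)) (drop‿+≤+ h)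
... | s≤s (s≤s ())
3i≤2⇒i≤0 -[1+ n ]  _ = -≤+

-- Measures imbalance: for a fixed total, the corners contain fewest points when this is least.
spread : ℤ → ℤ → ℤ → ℤ
spread a b c = (a - b) * (a - b) + (b - c) * (b - c) + (a - c) * (a - c)

-- Twice the number of points in triangles with `a`, `b` and `c` points on a side.
corners : ℤ → ℤ → ℤ → ℤ
corners a b c = a * (1ℤ + a) + b * (1ℤ + b) + c * (1ℤ + c)

-- This identity bounds the size of the corners below in terms of their
-- total side length.
3*corners : ∀ a b c → + 3 * corners a b c
  ≡ (a + b + c) * (a + b + c) + + 3 * (a + b + c) + spread a b c
3*corners = identity
  where
  identity : ∀ a b c → + 3 * (a * (1ℤ + a) + b * (1ℤ + b) + c * (1ℤ + c))
    ≡ (a + b + c) * (a + b + c) + + 3 * (a + b + c)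
      + ((a - b) * (a - b) + (b - c) * (b - c) + (a - c) * (a - c))
  identity = solve-∀

0≤spread : ∀ a b c → 0ℤ ≤ spread a b c
0≤spread a b c = 0≤i*i (a - b) ⊕ 0≤i*i (b - c) ⊕ 0≤i*i (a - c)

spread≤2⇒diff≤1 : ∀ a b c → spread a b c ≤ + 2 → a - b ≤ 1ℤ × b - c ≤ 1ℤ × a - c ≤ 1ℤ
spread≤2⇒diff≤1 a b c h =
  i*i≤2⇒i≤1 (a - b) (fst h (0≤i*i (b - c)) (0≤i*i (a - c))) ,
  i*i≤2⇒i≤1 (b - c) (snd h (0≤i*i (a - b)) (0≤i*i (a - c))) ,
  i*i≤2⇒i≤1 (a - c) (thd h (0≤i*i (a - b)) (0≤i*i (b - c)))
  where
  fst : ∀ {x y z} → x + y + z ≤ + 2 → 0ℤ ≤ y → 0ℤ ≤ z → x ≤ + 2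
  fst {x} {y} {z} h hy hz = linear (h ⊕ hy ⊕ hz) (solve (x ∷ y ∷ z ∷ []))
  snd : ∀ {x y z} → x + y + z ≤ + 2 → 0ℤ ≤ x → 0ℤ ≤ z → y ≤ + 2
  snd {x} {y} {z} h hx hz = linear (h ⊕ hx ⊕ hz) (solve (x ∷ y ∷ z ∷ []))
  thd : ∀ {x y z} → x + y + z ≤ + 2 → 0ℤ ≤ x → 0ℤ ≤ y → z ≤ + 2
  thd {x} {y} {z} h hx hy = linear (h ⊕ hx ⊕ hy) (solve (x ∷ y ∷ z ∷ []))

-- Twice the number of points in a triangle of side `S`, which has `S + 1` points on a side.
count : ℤ → ℤ
count S = (1ℤ + S) * (+ 2 + S)

-- `slack` adds the two excesses, of `d` and of the corner sum over `S`. The counting inequalities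
-- leave room for at most 2 while `slack` enters at least threefold, so it is at most 0 and both of
-- its nonnegative summands vanish.
squeeze : ∀ S d a b c L → 0ℤ ≤ S → S ≤ d → S ≤ a + b + c →
  count d ≤ + 3 * L → + 2 * L + corners a b c ≤ count S → d ≤ S × a + b + c ≤ S
squeeze S d a b c L 0≤S S≤d S≤σ h₁ h₂ =
  linear (slack≤0 ⊕ S≤σ) (split₁ S d (a + b + c)) , linear (slack≤0 ⊕ S≤d) (split₂ S d (a + b + c))
  where
  slack : ℤ
  slack = (d - S) + (a + b + c - S)

  split₁ : ∀ S d σ → d - S ≡ ((d - S) + (σ - S)) + S - (0ℤ + σ)
  split₁ = solve-∀
  split₂ : ∀ S d σ → σ - S ≡ ((d - S) + (σ - S)) + S - (0ℤ + d)
  split₂ = solve-∀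

  bound : ∀ σ C Q → S ≤ σ → 0ℤ ≤ Q → + 3 * C ≡ σ * σ + + 3 * σ + Q →
    (1ℤ + d) * (+ 2 + d) ≤ + 3 * L → + 2 * L + C ≤ (1ℤ + S) * (+ 2 + S) →
    + 3 * ((d - S) + (σ - S)) ≤ + 2
  bound σ C Q S≤σ 0≤Q eq h₁ h₂ = linear
    -- Three times `h₂` and twice `h₁` eliminate `L`; the remaining summands discard nonnegative
    -- terms until three times the slack is left.
    (h₂ ⊕ h₂ ⊕ h₂ ⊕ h₁ ⊕ h₁ ⊕ eq≥ eq ⊕ 0≤Q
      ⊕ Se ⊕ Se ⊕ Se ⊕ Se ⊕ 0≤i*i (d - S) ⊕ 0≤i*i (d - S) ⊕ S≤d ⊕ S≤d ⊕ S≤d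
      ⊕ Sg ⊕ Sg ⊕ 0≤i*i (σ - S))
    (solve (S ∷ d ∷ σ ∷ C ∷ Q ∷ L ∷ []))
    where
    Se : 0ℤ ≤ S * (d - S)
    Se = 0≤i*j 0≤S (i≤j⇒0≤j-i S≤d)
    Sg : 0ℤ ≤ S * (σ - S)
    Sg = 0≤i*j 0≤S (i≤j⇒0≤j-i S≤σ)

  slack≤0 : slack ≤ 0ℤ
  slack≤0 = 3i≤2⇒i≤0 slack (bound (a + b + c) (corners a b c) (spread a b c) S≤σ
    (0≤spread a b c) (3*corners a b c) h₁ h₂)

module _ (d a b c L : ℤ) (σ≡d : a + b + c ≡ d) where
  private
    3C≡ : + 3 * corners a b c ≡ d * d + + 3 * d + spread a b c
    3C≡ = subst (λ σ → + 3 * corners a b c ≡ σ * σ + + 3 * σ + spread a b c) σ≡d (3*corners a b c)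

  count-spread : count d ≤ + 3 * L → + 2 * L + corners a b c ≤ count d → spread a b c ≤ + 2
  count-spread = go (corners a b c) (spread a b c) 3C≡
    where
    go : ∀ C Q → + 3 * C ≡ d * d + + 3 * d + Q → (1ℤ + d) * (+ 2 + d) ≤ + 3 * L →
         + 2 * L + C ≤ (1ℤ + d) * (+ 2 + d) → Q ≤ + 2
    go C Q eq h₁ h₂ = linear (h₂ ⊕ h₂ ⊕ h₂ ⊕ h₁ ⊕ h₁ ⊕ eq≥ eq) (solve (d ∷ C ∷ Q ∷ L ∷ []))

  count-upper : + 2 * L + corners a b c ≤ count d → + 3 * L ≤ 1ℤ + count d
  count-upper = go (corners a b c) (spread a b c) (0≤spread a b c) 3C≡
    where
    go : ∀ C Q → 0ℤ ≤ Q → + 3 * C ≡ d * d + + 3 * d + Q →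
         + 2 * L + C ≤ (1ℤ + d) * (+ 2 + d) → + 3 * L ≤ 1ℤ + (1ℤ + d) * (+ 2 + d)
    go C Q 0≤Q eq h = *-cancelˡ-≤-pos _ _ (+ 2)
      (linear (h ⊕ h ⊕ h ⊕ eq≥ eq ⊕ 0≤Q) (solve (d ∷ C ∷ Q ∷ L ∷ [])))

  -- Spread at most 2 means 3 `corners` ≤ d² + 3d + 2 = `count d`: the corners take at most a third
  -- of the triangle.
  count-lower : spread a b c ≤ + 2 → count d ≤ + 2 * L + corners a b c → count d ≤ + 3 * L
  count-lower = go (corners a b c) (spread a b c) 3C≡
    where
    go : ∀ C Q → + 3 * C ≡ d * d + + 3 * d + Q → Q ≤ + 2 →
         (1ℤ + d) * (+ 2 + d) ≤ + 2 * L + C → (1ℤ + d) * (+ 2 + d) ≤ + 3 * L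
    go C Q eq Q≤2 h = *-cancelˡ-≤-pos _ _ (+ 2)
      (linear (h ⊕ h ⊕ h ⊕ eq≤ eq ⊕ Q≤2) (solve (d ∷ C ∷ Q ∷ L ∷ [])))

ceil3-unique : ∀ X L → X ℕ.≤ 3 ℕ.* L → 3 ℕ.* L ℕ.≤ suc X → L ≡ ceil3 X
ceil3-unique X L lower upper = ℕ.≤-antisym
  (subst (ℕ._≤ ceil3 X) (m*n/n≡m L 3) (/-monoˡ-≤ 3 (begin
    L ℕ.* 3      ≡⟨ ℕ.*-comm L 3 ⟩
    3 ℕ.* L      ≤⟨ upper ⟩
    1 ℕ.+ X      ≤⟨ ℕ.n≤1+n _ ⟩
    2 ℕ.+ X      ≡⟨ ℕ.+-comm 2 X ⟩
    X ℕ.+ 2      ∎)))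
  (ℕ.s≤s⁻¹ (m<n*o⇒m/o<n (begin-strict
    X ℕ.+ 2         <⟨ ℕ.n<1+n _ ⟩
    1 ℕ.+ (X ℕ.+ 2) ≡⟨ ℕ.+-comm 1 (X ℕ.+ 2) ⟩
    X ℕ.+ 2 ℕ.+ 1   ≡⟨ ℕ.+-assoc X 2 1 ⟩
    X ℕ.+ 3         ≤⟨ ℕ.+-monoˡ-≤ 3 lower ⟩
    3 ℕ.* L ℕ.+ 3   ≡⟨ mul L ⟩
    suc L ℕ.* 3     ∎)))
  where
  open ℕ.≤-Reasoning
  mul : ∀ L → 3 ℕ.* L ℕ.+ 3 ≡ (1 ℕ.+ L) ℕ.* 3
  mul = ℕR.solve-∀

-- Balanced corner sizes and the listed shapes.

data Balanced : ℕ → ℕ → ℕ → Set where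
  balanced   : ∀ k → Balanced k k k
  larger₁    : ∀ k → Balanced (suc k) k k
  larger₂    : ∀ k → Balanced k (suc k) k
  larger₃    : ∀ k → Balanced k k (suc k)
  smaller₁   : ∀ k → Balanced k (suc k) (suc k)
  smaller₂   : ∀ k → Balanced (suc k) k (suc k)
  smaller₃   : ∀ k → Balanced (suc k) (suc k) k

-- Lowering all three numbers by 1 keeps their differences, so only triples containing 0 are listed.
-- The position of the exceptional number is recorded because it decides the shape and whether to
-- rotate.
balanced⁺ : ∀ a b c → a ℕ.≤ suc b → b ℕ.≤ suc a → b ℕ.≤ suc c → c ℕ.≤ suc b → a ℕ.≤ suc c → c ℕ.≤ suc a →
  Balanced a b c
balanced⁺ 0 0 0 _ _ _ _ _ _ = balanced 0
balanced⁺ 1 0 0 _ _ _ _ _ _ = larger₁ 0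
balanced⁺ 0 1 0 _ _ _ _ _ _ = larger₂ 0
balanced⁺ 0 0 1 _ _ _ _ _ _ = larger₃ 0
balanced⁺ 0 1 1 _ _ _ _ _ _ = smaller₁ 0
balanced⁺ 1 0 1 _ _ _ _ _ _ = smaller₂ 0
balanced⁺ 1 1 0 _ _ _ _ _ _ = smaller₃ 0
balanced⁺ (suc a) (suc b) (suc c) (s≤s h₁) (s≤s h₂) (s≤s h₃) (s≤s h₄) (s≤s h₅) (s≤s h₆)
  with balanced⁺ a b c h₁ h₂ h₃ h₄ h₅ h₆
... | balanced k = balanced (suc k)
... | larger₁ k  = larger₁ (suc k)
... | larger₂ k  = larger₂ (suc k)
... | larger₃ k  = larger₃ (suc k)
... | smaller₁ k = smaller₁ (suc k)
... | smaller₂ k = smaller₂ (suc k)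
... | smaller₃ k = smaller₃ (suc k)
balanced⁺ (suc (suc _)) 0 _ (s≤s ()) _ _ _ _ _
balanced⁺ (suc (suc _)) _ 0 _ _ _ _ (s≤s ()) _
balanced⁺ 0 (suc (suc _)) _ _ (s≤s ()) _ _ _ _
balanced⁺ _ (suc (suc _)) 0 _ _ (s≤s ()) _ _ _
balanced⁺ 0 _ (suc (suc _)) _ _ _ _ _ (s≤s ())
balanced⁺ _ 0 (suc (suc _)) _ _ _ (s≤s ()) _ _

spread-comm : ∀ a b c → spread a b c ≡ spread c b a
spread-comm a b c = eq a b c
  where
  eq : ∀ a b c → (a - b) * (a - b) + (b - c) * (b - c) + (a - c) * (a - c)
               ≡ (c - b) * (c - b) + (b - a) * (b - a) + (c - a) * (c - a)
  eq = solve-∀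

spread≤2⇒balanced : ∀ {a b c} → spread (+ a) (+ b) (+ c) ≤ + 2 → Balanced a b c
spread≤2⇒balanced {a} {b} {c} h =
  let ab , bc , ac = spread≤2⇒diff≤1 (+ a) (+ b) (+ c) h
      -- Differences are bounded from above only; the reversed triple has the same spread and
      -- supplies the opposite signs.
      cb , ba , ca = spread≤2⇒diff≤1 (+ c) (+ b) (+ a) (subst (_≤ + 2) (spread-comm (+ a) (+ b) (+ c)) h)
  in balanced⁺ a b c (conv ab) (conv ba) (conv bc) (conv cb) (conv ac) (conv ca)
  where
  conv : ∀ {m n} → + m - + n ≤ 1ℤ → m ℕ.≤ suc n
  conv {m} {n} h = drop‿+≤+ (linear h (eq (+ m) (+ n)))
    where
    eq : ∀ m n → m - (1ℤ + n) ≡ m - n - 1ℤ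
    eq = solve-∀

∈-shapes₀ : ∀ k → (2 ℕ.* k , 2 ℕ.* k , k) ∈ shapes (k ℕ.* 3)
∈-shapes₀ k rewrite m*n%n≡0 k 3 ⦃ _ ⦄ = here (cong₂ _,_ e (cong₂ _,_ e (sym (m*n/n≡m k 3))))
  where
  e : 2 ℕ.* k ≡ 2 ℕ.* (k ℕ.* 3) / 3
  e = sym (trans (cong (_/ 3) (sym (ℕ.*-assoc 2 k 3))) (m*n/n≡m (2 ℕ.* k) 3))

exact : ∀ {m} n → m ≡ n ℕ.* 3 → n ≡ m / 3
exact n refl = sym (m*n/n≡m n 3)

∈-shapes₁ : ∀ k → (1 ℕ.+ 2 ℕ.* k , 1 ℕ.+ 2 ℕ.* k , 1 ℕ.+ k) ∈ shapes (1 ℕ.+ k ℕ.* 3)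
                × (1 ℕ.+ 2 ℕ.* k , 2 ℕ.* k , k) ∈ shapes (1 ℕ.+ k ℕ.* 3)
∈-shapes₁ k rewrite [m+kn]%n≡m%n 1 k 3 ⦃ _ ⦄ =
  here (cong₂ _,_ (exact _ (e₁ k)) (cong₂ _,_ (exact _ (e₁ k)) (exact _ (e₂ k)))) ,
  there (here (cong₂ _,_ (exact _ (e₁ k)) (cong₂ _,_ (exact _ (cong (ℕ._∸ 2) (e₃ k))) (exact k refl))))
  where
  e₁ : ∀ k → 2 ℕ.* (1 ℕ.+ k ℕ.* 3) ℕ.+ 1 ≡ (1 ℕ.+ 2 ℕ.* k) ℕ.* 3
  e₁ = ℕR.solve-∀
  e₂ : ∀ k → 1 ℕ.+ k ℕ.* 3 ℕ.+ 2 ≡ (1 ℕ.+ k) ℕ.* 3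
  e₂ = ℕR.solve-∀
  e₃ : ∀ k → 2 ℕ.* (1 ℕ.+ k ℕ.* 3) ≡ 2 ℕ.+ 2 ℕ.* k ℕ.* 3
  e₃ = ℕR.solve-∀

∈-shapes₂ : ∀ k → (1 ℕ.+ 2 ℕ.* k , 1 ℕ.+ 2 ℕ.* k , k) ∈ shapes (2 ℕ.+ k ℕ.* 3)
                × (2 ℕ.+ 2 ℕ.* k , 1 ℕ.+ 2 ℕ.* k , 1 ℕ.+ k) ∈ shapes (2 ℕ.+ k ℕ.* 3)
∈-shapes₂ k rewrite [m+kn]%n≡m%n 2 k 3 ⦃ _ ⦄ =
  here (cong₂ _,_ half (cong₂ _,_ half (exact k refl))) ,
  there (here (cong₂ _,_ (exact _ (e₂ k)) (cong₂ _,_ half (exact _ (e₃ k)))))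
  where
  e₁ : ∀ k → 2 ℕ.* (2 ℕ.+ k ℕ.* 3) ≡ 1 ℕ.+ (1 ℕ.+ 2 ℕ.* k) ℕ.* 3
  e₁ = ℕR.solve-∀
  half : 1 ℕ.+ 2 ℕ.* k ≡ (2 ℕ.* (2 ℕ.+ k ℕ.* 3) ℕ.∸ 1) / 3
  half = exact _ (cong (ℕ._∸ 1) (e₁ k))
  e₂ : ∀ k → 2 ℕ.* (2 ℕ.+ k ℕ.* 3) ℕ.+ 2 ≡ (2 ℕ.+ 2 ℕ.* k) ℕ.* 3
  e₂ = ℕR.solve-∀
  e₃ : ∀ k → 2 ℕ.+ k ℕ.* 3 ℕ.+ 1 ≡ (1 ℕ.+ k) ℕ.* 3
  e₃ = ℕR.solve-∀

-- In a triangle of side `d`, cutting `tᵢ` at corner `i` leaves the range of `fᵢ` with width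
-- `d - tᵢ`. The first two widths are `a` and `b`; the third corner size is the common value of c₁
-- and c₃.
HasShape : ℕ → ℕ → ℕ → ℕ → Set
HasShape d t₁ t₂ t₃ = ∃[ a ] ∃[ b ] a ℕ.+ t₁ ≡ d × b ℕ.+ t₂ ≡ d × (a , b , t₃) ∈ shapes d

-- Rotating by π/3 permutes the corner sizes cyclically.
balanced⇒shape : ∀ {d t₁ t₂ t₃} → Balanced t₁ t₂ t₃ → t₁ ℕ.+ t₂ ℕ.+ t₃ ≡ d →
  HasShape d t₁ t₂ t₃ ⊎ HasShape d t₃ t₁ t₂
balanced⇒shape = λ where
    (balanced k) eq → inj₁ (shape eq (s₀ k) (_ , _ , a₀ k , a₀ k , ∈-shapes₀ k))
    -- Unrotated, this would be `(2k, 2k+1, k)`, which is not listed; rotation moves the large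
    -- corner to second place. For `smaller₂` it likewise moves the small corner to third place.
    (larger₁ k)  eq → inj₂ (shape eq (s₁₁ k) (_ , _ , a₁ k , b₁ k , proj₂ (∈-shapes₁ k)))
    (larger₂ k)  eq → inj₁ (shape eq (s₁₂ k) (_ , _ , a₁ k , b₁ k , proj₂ (∈-shapes₁ k)))
    (larger₃ k)  eq → inj₁ (shape eq (s₁₃ k) (_ , _ , a₁ k , a₁ k , proj₁ (∈-shapes₁ k)))
    (smaller₁ k) eq → inj₁ (shape eq (s₂₁ k) (_ , _ , b₂ k , a₂ k , proj₂ (∈-shapes₂ k)))
    (smaller₂ k) eq → inj₂ (shape eq (s₂₂ k) (_ , _ , a₂ k , a₂ k , proj₁ (∈-shapes₂ k)))
    (smaller₃ k) eq → inj₁ (shape eq (s₂₃ k) (_ , _ , a₂ k , a₂ k , proj₁ (∈-shapes₂ k)))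
  where
  shape : ∀ {d s t₁ t₂ t₃ e} → s ≡ d → s ≡ e → HasShape e t₁ t₂ t₃ → HasShape d t₁ t₂ t₃
  shape refl refl h = h

  s₀ : ∀ k → k ℕ.+ k ℕ.+ k ≡ k ℕ.* 3
  s₀ = ℕR.solve-∀
  s₁₁ : ∀ k → 1 ℕ.+ k ℕ.+ k ℕ.+ k ≡ 1 ℕ.+ k ℕ.* 3
  s₁₁ = ℕR.solve-∀
  s₁₂ : ∀ k → k ℕ.+ (1 ℕ.+ k) ℕ.+ k ≡ 1 ℕ.+ k ℕ.* 3
  s₁₂ = ℕR.solve-∀
  s₁₃ : ∀ k → k ℕ.+ k ℕ.+ (1 ℕ.+ k) ≡ 1 ℕ.+ k ℕ.* 3
  s₁₃ = ℕR.solve-∀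
  s₂₁ : ∀ k → k ℕ.+ (1 ℕ.+ k) ℕ.+ (1 ℕ.+ k) ≡ 2 ℕ.+ k ℕ.* 3
  s₂₁ = ℕR.solve-∀
  s₂₂ : ∀ k → 1 ℕ.+ k ℕ.+ k ℕ.+ (1 ℕ.+ k) ≡ 2 ℕ.+ k ℕ.* 3
  s₂₂ = ℕR.solve-∀
  s₂₃ : ∀ k → 1 ℕ.+ k ℕ.+ (1 ℕ.+ k) ℕ.+ k ≡ 2 ℕ.+ k ℕ.* 3
  s₂₃ = ℕR.solve-∀
  a₀ : ∀ k → 2 ℕ.* k ℕ.+ k ≡ k ℕ.* 3
  a₀ = ℕR.solve-∀
  a₁ : ∀ k → 1 ℕ.+ 2 ℕ.* k ℕ.+ k ≡ 1 ℕ.+ k ℕ.* 3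
  a₁ = ℕR.solve-∀
  b₁ : ∀ k → 2 ℕ.* k ℕ.+ (1 ℕ.+ k) ≡ 1 ℕ.+ k ℕ.* 3
  b₁ = ℕR.solve-∀
  a₂ : ∀ k → 1 ℕ.+ 2 ℕ.* k ℕ.+ (1 ℕ.+ k) ≡ 2 ℕ.+ k ℕ.* 3
  a₂ = ℕR.solve-∀
  b₂ : ∀ k → 2 ℕ.+ 2 ℕ.* k ℕ.+ k ≡ 2 ℕ.+ k ℕ.* 3
  b₂ = ℕR.solve-∀

balanced-partition : ∀ d → ∃[ t₁ ] ∃[ t₂ ] ∃[ t₃ ] t₁ ℕ.+ t₂ ℕ.+ t₃ ≡ d × spread (+ t₁) (+ t₂) (+ t₃) ≤ + 2
balanced-partition d with d % 3 | d / 3 | m≡m%n+[m/n]*n d 3 | m%n<n d 3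
... | 0 | k | eq | _ = k , k , k , trans (s k) (sym eq) ,
  ≤-trans (eq≤ (e (+ k))) (+≤+ z≤n)
  where
  s : ∀ k → k ℕ.+ k ℕ.+ k ≡ k ℕ.* 3
  s = ℕR.solve-∀
  e : ∀ k → (k - k) * (k - k) + (k - k) * (k - k) + (k - k) * (k - k) ≡ 0ℤ
  e = solve-∀
... | 1 | k | eq | _ = k , k , suc k , trans (s k) (sym eq) , eq≤ (e (+ k))
  where
  s : ∀ k → k ℕ.+ k ℕ.+ (1 ℕ.+ k) ≡ 1 ℕ.+ k ℕ.* 3
  s = ℕR.solve-∀
  e : ∀ k → (k - k) * (k - k) + (k - (1ℤ + k)) * (k - (1ℤ + k)) + (k - (1ℤ + k)) * (k - (1ℤ + k)) ≡ + 2
  e = solve-∀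
... | 2 | k | eq | _ = suc k , suc k , k , trans (s k) (sym eq) , eq≤ (e (+ k))
  where
  s : ∀ k → 1 ℕ.+ k ℕ.+ (1 ℕ.+ k) ℕ.+ k ≡ 2 ℕ.+ k ℕ.* 3
  s = ℕR.solve-∀
  e : ∀ k → (1ℤ + k - (1ℤ + k)) * (1ℤ + k - (1ℤ + k)) + (1ℤ + k - k) * (1ℤ + k - k)
            + (1ℤ + k - k) * (1ℤ + k - k) ≡ + 2
  e = solve-∀
... | suc (suc (suc _)) | _ | _ | s≤s (s≤s (s≤s ()))

-- An explicit large anticode.

hexagon-anticode : ∀ {d A} H → Unique A → (∀ {p} → p ∈ A → p ∈ₕ H) →
  upSize H ≤ + d → downSize H ≤ + d → IsAnticode d A
hexagon-anticode H unique A⊆H up≤ down≤ =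
  unique , λ p∈ q∈ r∈ → hexagon-tristance H up≤ down≤ (A⊆H p∈) (A⊆H q∈) (A⊆H r∈)

cast-count : ∀ s → + (suc s ℕ.* suc (suc s)) ≡ count (+ s)
cast-count s = pos-* (suc s) (suc (suc s))

cast-pieces : ∀ L a b c → + (2 ℕ.* L ℕ.+ (a ℕ.* suc a ℕ.+ b ℕ.* suc b ℕ.+ c ℕ.* suc c))
  ≡ + 2 * + L + corners (+ a) (+ b) (+ c)
cast-pieces L a b c = cong₂ _+_ (pos-* 2 L)
  (cong₂ _+_ (cong₂ _+_ (pos-* a (suc a)) (pos-* b (suc b))) (pos-* c (suc c)))

large-anticode : ∀ d → ∃[ B ] IsAnticode d B × count (+ d) ≤ + 3 * + length B
large-anticode d with balanced-partition d
... | t₁ , t₂ , t₃ , sum , spread≤2 =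
  points ,
  hexagon-anticode H (Unique.filter⁺ (∈ₕ? H) (triangle-unique (+ d) 0ℤ (suc d)))
    (λ p∈ → proj₂ (∈-filter⁻ (∈ₕ? H) {xs = big} p∈))
    (eq≤ (Truncation.side truncation)) (eq≤ (down (+ t₁) (+ t₂) (+ t₃) (+ d) (cong +_ sum))) ,
  count-lower (+ d) (+ t₁) (+ t₂) (+ t₃) (+ length points) (cong +_ sum) spread≤2
    (subst₂ _≤_ (cast-count d) (cast-pieces (length points) t₁ t₂ t₃) (+≤+ count≥))
  where
  H : Hexagon
  -- The maxima `d`, 0, 0 give a triangle of side `d`, and the minima are solved from the prescribed
  -- corner sizes. As these add up to `d`, the opposite triangle has side `d` too.
  H = hexagon (+ t₁) (+ t₂ - + d) (+ t₃ - + d) (+ d) 0ℤ 0ℤ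

  c₁ : ∀ t → t + 0ℤ + 0ℤ ≡ t
  c₁ = solve-∀
  c₂ : ∀ t d → d + (t - d) + 0ℤ ≡ t
  c₂ = solve-∀
  c₃ : ∀ t d → d + 0ℤ + (t - d) ≡ t
  c₃ = solve-∀
  down : ∀ a b c d → a + b + c ≡ d → - (a + (b - d) + (c - d)) ≡ d
  down a b c .(a + b + c) refl = solve (a ∷ b ∷ c ∷ [])

  truncation : Truncation H d t₁ t₂ t₃
  truncation = record
    { side = c₁ (+ d) ; corner₁ = c₁ (+ t₁) ; corner₂ = c₂ (+ t₂) (+ d) ; corner₃ = c₃ (+ t₃) (+ d) }
  open Counting truncation

-- Bounding hexagons of anticodes.

Attained : (Point → ℤ) → ℤ → List Point → Set
Attained g z A = ∃[ p ] p ∈ A × g p ≡ z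

-- The bounds have to be attained: the extremal points are the triples to which the diameter is
-- applied, and they also make the corner sizes nonnegative and the corners disjoint.
record Hull (H : Hexagon) (A : List Point) : Set where
  open Hexagon H
  field
    inside : ∀ {p} → p ∈ A → p ∈ₕ H
    min₁ : Attained f₁ n₁ A
    min₂ : Attained f₂ n₂ A
    min₃ : Attained f₃ n₃ A
    max₁ : Attained f₁ M₁ A
    max₂ : Attained f₂ M₂ A
    max₃ : Attained f₃ M₃ A

maximum : ∀ (g : Point → ℤ) a A → ∃[ m ] m ∈ a ∷ A × (∀ {p} → p ∈ a ∷ A → g p ≤ g m)
maximum g a A = argmax g a A , member (argmax-sel g a A) , bound
  where
  member : argmax g a A ≡ a ⊎ argmax g a A ∈ A → argmax g a A ∈ a ∷ A
  member (inj₁ eq) = here eq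
  member (inj₂ m∈) = there m∈
  bound : ∀ {p} → p ∈ a ∷ A → g p ≤ g (argmax g a A)
  bound (here refl) = f[⊥]≤f[argmax] {f = g} a A
  bound (there p∈)  = All.lookup (f[xs]≤f[argmax] {f = g} a A) p∈

hull : ∀ a A → ∃[ H ] Hull H (a ∷ A)
hull a A =
  let p₁ , p₁∈ , p₁-max = maximum f₁ a A
      p₂ , p₂∈ , p₂-max = maximum f₂ a A
      p₃ , p₃∈ , p₃-max = maximum f₃ a A
      q₁ , q₁∈ , q₁-max = maximum (-_ ∘ f₁) a A
      q₂ , q₂∈ , q₂-max = maximum (-_ ∘ f₂) a A
      q₃ , q₃∈ , q₃-max = maximum (-_ ∘ f₃) a A
  in hexagon (f₁ q₁) (f₂ q₂) (f₃ q₃) (f₁ p₁) (f₂ p₂) (f₃ p₃) , record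
    { inside = λ p∈ → (neg-cancel-≤ (q₁-max p∈) , p₁-max p∈) , (neg-cancel-≤ (q₂-max p∈) , p₂-max p∈)
                      , (neg-cancel-≤ (q₃-max p∈) , p₃-max p∈)
    ; min₁ = q₁ , q₁∈ , refl ; min₂ = q₂ , q₂∈ , refl ; min₃ = q₃ , q₃∈ , refl
    ; max₁ = p₁ , p₁∈ , refl ; max₂ = p₂ , p₂∈ , refl ; max₃ = p₃ , p₃∈ , refl }

-- A tree of at most `d` edges joins the points attaining the three maxima, and another those
-- attaining the three minima; the tree bound applies to each.
hull-sizes : ∀ {d H A} → Hull H A → IsAnticode d A → upSize H ≤ + d × downSize H ≤ + d
hull-sizes {d} {H} hullHA (_ , close) = up≤ , down≤
  where
  open Hexagon H
  open Hull hullHA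
  up≤ : M₁ + M₂ + M₃ ≤ + d
  up≤ with max₁ | max₂ | max₃
  ... | _ , p∈ , refl | _ , q∈ , refl | _ , r∈ , refl with close p∈ q∈ r∈
  ... | _ , _ , tree , p∈′ , q∈′ , r∈′ , k≤d = ≤-trans (tree-bound f-triple tree p∈′ q∈′ r∈′) (+≤+ k≤d)
  down≤ : - (n₁ + n₂ + n₃) ≤ + d
  down≤ with min₁ | min₂ | min₃
  ... | p , p∈ , refl | q , q∈ , refl | r , r∈ , refl with close p∈ q∈ r∈
  ... | _ , _ , tree , p∈′ , q∈′ , r∈′ , k≤d =
    subst (_≤ + d) (eq (f₁ p) (f₂ q) (f₃ r)) (≤-trans (tree-bound neg-triple tree p∈′ q∈′ r∈′) (+≤+ k≤d))
    where
    eq : ∀ a b c → - a + - b + - c ≡ - (a + b + c)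
    eq = solve-∀

-- At a point attaining `n₁` the coordinates sum to 0 while the other two are at most `M₂` and `M₃`,
-- so corner 1 has nonnegative size; the other corners are alike.
truncate : ∀ {H A} → Hull H A → ∃[ s ] ∃[ t₁ ] ∃[ t₂ ] ∃[ t₃ ] Truncation H s t₁ t₂ t₃
truncate {H} hullHA = _ , _ , _ , _ , record
  { side = sym (0≤i⇒+∣i∣≡i 0≤side) ; corner₁ = sym (0≤i⇒+∣i∣≡i 0≤corner₁)
  ; corner₂ = sym (0≤i⇒+∣i∣≡i 0≤corner₂) ; corner₃ = sym (0≤i⇒+∣i∣≡i 0≤corner₃) }
  where
  open Hexagon H
  open Hull hullHA
  0≤corner₁ : 0ℤ ≤ n₁ + M₂ + M₃
  0≤corner₁ with min₁
  ... | p , p∈ , refl with inside p∈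
  ... | _ , (_ , h₂) , (_ , h₃) = subst (_≤ f₁ p + M₂ + M₃) (f-sum p) (≤-refl {f₁ p} ⊕ h₂ ⊕ h₃)
  0≤corner₂ : 0ℤ ≤ M₁ + n₂ + M₃
  0≤corner₂ with min₂
  ... | p , p∈ , refl with inside p∈
  ... | (_ , h₁) , _ , (_ , h₃) = subst (_≤ M₁ + f₂ p + M₃) (f-sum p) (h₁ ⊕ ≤-refl {f₂ p} ⊕ h₃)
  0≤corner₃ : 0ℤ ≤ M₁ + M₂ + n₃
  0≤corner₃ with min₃
  ... | p , p∈ , refl with inside p∈
  ... | (_ , h₁) , (_ , h₂) , _ = subst (_≤ M₁ + M₂ + f₃ p) (f-sum p) (h₁ ⊕ h₂ ⊕ ≤-refl {f₃ p})
  0≤side : 0ℤ ≤ M₁ + M₂ + M₃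
  0≤side with min₁
  ... | p , p∈ , _ with inside p∈
  ... | (_ , h₁) , (_ , h₂) , (_ , h₃) = subst (_≤ M₁ + M₂ + M₃) (f-sum p) (h₁ ⊕ h₂ ⊕ h₃)

-- Corners 1 and 2 are disjoint because a point attaining `M₃` has its other coordinates at least
-- `n₁` and `n₂`, which forces `n₁ + n₂ + M₃ ≤ 0`; the other pairs are alike.
hull-count : ∀ {H A s t₁ t₂ t₃} → Hull H A → Unique A → Truncation H s t₁ t₂ t₃ →
  + 2 * + length A + corners (+ t₁) (+ t₂) (+ t₃) ≤ count (+ s)
hull-count {H} {A} {s} {t₁} {t₂} {t₃} hullHA unique T =
  subst₂ _≤_ (cast-pieces (length A) t₁ t₂ t₃) (cast-count s)
    (+≤+ (Counting.count≤ T unique inside n≤M₁ n≤M₂ n≤M₃ d₁₂ d₁₃ d₂₃))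
  where
  open Hexagon H
  open Hull hullHA
  n≤M₁ : n₁ ≤ M₁
  n≤M₁ = let _ , p∈ , _ = min₁ ; (h , h′) , _ = inside p∈ in ≤-trans h h′
  n≤M₂ : n₂ ≤ M₂
  n≤M₂ = let _ , p∈ , _ = min₁ ; _ , (h , h′) , _ = inside p∈ in ≤-trans h h′
  n≤M₃ : n₃ ≤ M₃
  n≤M₃ = let _ , p∈ , _ = min₁ ; _ , _ , (h , h′) = inside p∈ in ≤-trans h h′
  d₁₂ : n₁ + n₂ + M₃ ≤ 0ℤ
  d₁₂ with max₃
  ... | p , p∈ , refl with inside p∈
  ... | (h₁ , _) , (h₂ , _) , _ = subst (n₁ + n₂ + f₃ p ≤_) (f-sum p) (h₁ ⊕ h₂ ⊕ ≤-refl {f₃ p})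
  d₁₃ : n₁ + M₂ + n₃ ≤ 0ℤ
  d₁₃ with max₂
  ... | p , p∈ , refl with inside p∈
  ... | (h₁ , _) , _ , (h₃ , _) = subst (n₁ + f₂ p + n₃ ≤_) (f-sum p) (h₁ ⊕ ≤-refl {f₂ p} ⊕ h₃)
  d₂₃ : M₁ + n₂ + n₃ ≤ 0ℤ
  d₂₃ with max₁
  ... | p , p∈ , refl with inside p∈
  ... | _ , (h₂ , _) , (h₃ , _) = subst (f₁ p + n₂ + n₃ ≤_) (f-sum p) (≤-refl {f₁ p} ⊕ h₂ ⊕ h₃)

corner-sum : ∀ {H s t₁ t₂ t₃} → Truncation H s t₁ t₂ t₃ →
  + t₁ + + t₂ + + t₃ ≡ upSize H + upSize H - downSize H
corner-sum {H} T = trans (cong₂ _+_ (cong₂ _+_ (sym corner₁) (sym corner₂)) (sym corner₃))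
  (eq n₁ n₂ n₃ M₁ M₂ M₃)
  where
  open Hexagon H
  open Truncation T
  eq : ∀ n₁ n₂ n₃ M₁ M₂ M₃ → (n₁ + M₂ + M₃) + (M₁ + n₂ + M₃) + (M₁ + M₂ + n₃)
     ≡ (M₁ + M₂ + M₃) + (M₁ + M₂ + M₃) - - (n₁ + n₂ + n₃)
  eq = solve-∀

-- Only the larger of the two triangles around A has to be considered.
sizes-maximal : ∀ {d H A} → Hull H A → Unique A → count (+ d) ≤ + 3 * + length A →
  upSize H ≤ + d → downSize H ≤ upSize H → upSize H ≡ + d × downSize H ≡ + d
sizes-maximal {d} {H} {A} hullHA unique large up≤d down≤up =
  let s , t₁ , t₂ , t₃ , T = truncate hullHA in go T
  where
  go : ∀ {s t₁ t₂ t₃} → Truncation H s t₁ t₂ t₃ → upSize H ≡ + d × downSize H ≡ + d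
  go {s} {t₁} {t₂} {t₃} T = up≡ , ≤-antisym (≤-trans down≤up up≤d) (≤-trans (eq≥ up≡) up≤down)
    where
    open Truncation T
    s≤σ : + s ≤ + t₁ + + t₂ + + t₃
    s≤σ = subst₂ _≤_ side (sym (corner-sum T)) (linear down≤up (eq (upSize H) (downSize H)))
      where
      eq : ∀ u v → u - (u + u - v) ≡ v - u
      eq = solve-∀
    tight : + d ≤ + s × + t₁ + + t₂ + + t₃ ≤ + s
    tight = squeeze (+ s) (+ d) (+ t₁) (+ t₂) (+ t₃) (+ length A) (+≤+ z≤n)
      (subst (_≤ + d) side up≤d) s≤σ large (hull-count hullHA unique T)
    up≡ : upSize H ≡ + d
    up≡ = ≤-antisym up≤d (subst (+ d ≤_) (sym side) (proj₁ tight))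
    up≤down : upSize H ≤ downSize H
    up≤down = linear (subst₂ _≤_ (corner-sum T) (sym side) (proj₂ tight)) (eq (upSize H) (downSize H))
      where
      eq : ∀ u v → u - v ≡ u + u - v - u
      eq = solve-∀

-- Reflection in the origin.

negₚ : Point → Point
negₚ (x , y) = - x , - y

negₚ-injective : ∀ {p q} → negₚ p ≡ negₚ q → p ≡ q
negₚ-injective eq = cong₂ _,_ (neg-injective (cong proj₁ eq)) (neg-injective (cong proj₂ eq))

f₃-neg : ∀ p → f₃ (negₚ p) ≡ - f₃ p
f₃-neg (x , y) = eq
  where
  eq : - y - - x ≡ - (y - x)
  eq = solve (x ∷ y ∷ [])

negₕ : Hexagon → Hexagon
negₕ (hexagon n₁ n₂ n₃ M₁ M₂ M₃) = hexagon (- M₁) (- M₂) (- M₃) (- n₁) (- n₂) (- n₃)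

neg-hull : ∀ {H A} → Hull H A → Hull (negₕ H) (map negₚ A)
neg-hull {H} {A} hullHA = record
  { inside = λ p∈ → inside′ (∈-map⁻ negₚ p∈)
  ; min₁ = flip f₁ (λ _ → refl) max₁ ; min₂ = flip f₂ (λ _ → refl) max₂ ; min₃ = flip f₃ f₃-neg max₃
  ; max₁ = flip f₁ (λ _ → refl) min₁ ; max₂ = flip f₂ (λ _ → refl) min₂ ; max₃ = flip f₃ f₃-neg min₃ }
  where
  open Hexagon H
  open Hull hullHA
  flip : ∀ (g : Point → ℤ) {z} → (∀ p → g (negₚ p) ≡ - g p) → Attained g z A → Attained g (- z) (map negₚ A)
  flip g g-neg (p , p∈ , refl) = negₚ p , ∈-map⁺ negₚ p∈ , g-neg p
  inside′ : ∀ {p} → ∃[ q ] (q ∈ A × p ≡ negₚ q) → p ∈ₕ negₕ H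
  inside′ (q , q∈ , refl) with inside q∈
  ... | (l₁ , h₁) , (l₂ , h₂) , (l₃ , h₃) =
    (neg-mono-≤ h₁ , neg-mono-≤ l₁) , (neg-mono-≤ h₂ , neg-mono-≤ l₂) ,
    (subst (_ ≤_) (sym (f₃-neg q)) (neg-mono-≤ h₃) , subst (_≤ _) (sym (f₃-neg q)) (neg-mono-≤ l₃))

upSize-neg : ∀ H → upSize (negₕ H) ≡ downSize H
upSize-neg (hexagon n₁ n₂ n₃ _ _ _) = eq n₁ n₂ n₃
  where
  eq : ∀ a b c → - a + - b + - c ≡ - (a + b + c)
  eq = solve-∀

downSize-neg : ∀ H → downSize (negₕ H) ≡ upSize H
downSize-neg (hexagon _ _ _ M₁ M₂ M₃) = eq M₁ M₂ M₃
  where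
  eq : ∀ a b c → - (- a + - b + - c) ≡ a + b + c
  eq = solve-∀

-- Reflection exchanges the two triangles. Largeness is stated through the length alone, so it
-- passes to `map negₚ A` at once.
sizes≡ : ∀ {d H A} → Hull H A → Unique A → count (+ d) ≤ + 3 * + length A →
  upSize H ≤ + d → downSize H ≤ + d → upSize H ≡ + d × downSize H ≡ + d
sizes≡ {d} {H} {A} hullHA unique large up≤ down≤ with ≤-total (downSize H) (upSize H)
... | inj₁ down≤up = sizes-maximal hullHA unique large up≤ down≤up
... | inj₂ up≤down =
  let up′ , down′ = sizes-maximal (neg-hull hullHA) (Unique.map⁺ negₚ-injective unique)
        (subst (λ l → count (+ d) ≤ + 3 * + l) (sym (length-map negₚ A)) large)
        (subst (_≤ + d) (sym (upSize-neg H)) down≤)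
        (subst₂ _≤_ (sym (downSize-neg H)) (sym (upSize-neg H)) up≤down)
  in trans (sym (downSize-neg H)) down′ , trans (sym (upSize-neg H)) up′

count≰0 : ∀ d → ¬ (count (+ d) ≤ 0ℤ)
count≰0 d h with subst (_≤ 0ℤ) (sym (cast-count d)) h
... | +≤+ ()

-- The diameter is controlled by the sizes of `H` alone, so a point of `H` missing from `A` could be
-- adjoined, against maximality.
optimal⇔hexagon : ∀ {d H A} → IsOptimalAnticode d A → Hull H A → upSize H ≤ + d → downSize H ≤ + d →
  ∀ p → p ∈ A ⇔ p ∈ₕ H
optimal⇔hexagon {d} {H} {A} ((unique , _) , maximal) hullHA up≤ down≤ p = mk⇔ inside fill
  where
  open Hull hullHA
  fill : p ∈ₕ H → p ∈ A
  fill p∈H with p ∈? A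
  ... | yes p∈A = p∈A
  ... | no p∉A = contradiction (maximal (p ∷ A) larger) (ℕ.<⇒≱ (ℕ.n<1+n _))
    where
    larger : IsAnticode d (p ∷ A)
    larger = hexagon-anticode H (All.¬Any⇒All¬ A p∉A ∷ unique)
      (λ { (here refl) → p∈H ; (there q∈) → inside q∈ }) up≤ down≤

-- Hexagons in the normal form `InH`.

module _ {n₁ n₂ n₃ M₁ M₂ M₃ : ℤ} (zero-sum : n₁ + n₂ + n₃ + (M₁ + M₂ + M₃) ≡ 0ℤ) where

  -- The bound `n₃` turns into the upper bound on x - y and makes c₁ the third corner size; `M₃`
  -- turns into the lower bound and makes c₃ equal to -(n₁ + n₂ + M₃). By `zero-sum` the two agree.
  translated : ∀ p → p ∈ₕ hexagon n₁ n₂ n₃ M₁ M₂ M₃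
    ⇔ InH (M₁ - n₁) (M₂ - n₂) (M₁ + M₂ + n₃) (M₁ + M₂ + n₃) (translate (- n₁ , M₂) p)
  translated (x , y) = mk⇔ to from
    where
    to : (n₁ ≤ x × x ≤ M₁) × (n₂ ≤ - y × - y ≤ M₂) × (n₃ ≤ y - x × y - x ≤ M₃) →
      (0ℤ ≤ x + - n₁ × x + - n₁ ≤ M₁ - n₁) × (0ℤ ≤ y + M₂ × y + M₂ ≤ M₂ - n₂)
      × (M₁ + M₂ + n₃ - (M₂ - n₂) ≤ x + - n₁ - (y + M₂) × x + - n₁ - (y + M₂) ≤ M₁ - n₁ - (M₁ + M₂ + n₃))
    to ((a , b) , (c , d) , (e , f)) =
      (linear a (solve (n₁ ∷ x ∷ [])) , linear b (solve (n₁ ∷ M₁ ∷ x ∷ []))) ,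
      (linear d (solve (M₂ ∷ y ∷ [])) , linear c (solve (n₂ ∷ M₂ ∷ y ∷ []))) ,
      (linear (f ⊕ eq≤ zero-sum) (solve (n₁ ∷ n₂ ∷ n₃ ∷ M₁ ∷ M₂ ∷ M₃ ∷ x ∷ y ∷ [])) ,
       linear e (solve (n₁ ∷ n₃ ∷ M₁ ∷ M₂ ∷ x ∷ y ∷ [])))
    from : (0ℤ ≤ x + - n₁ × x + - n₁ ≤ M₁ - n₁) × (0ℤ ≤ y + M₂ × y + M₂ ≤ M₂ - n₂)
      × (M₁ + M₂ + n₃ - (M₂ - n₂) ≤ x + - n₁ - (y + M₂) × x + - n₁ - (y + M₂) ≤ M₁ - n₁ - (M₁ + M₂ + n₃)) →
      (n₁ ≤ x × x ≤ M₁) × (n₂ ≤ - y × - y ≤ M₂) × (n₃ ≤ y - x × y - x ≤ M₃)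
    from ((a , b) , (c , d) , (e , f)) =
      (linear a (solve (n₁ ∷ x ∷ [])) , linear b (solve (n₁ ∷ M₁ ∷ x ∷ []))) ,
      (linear d (solve (n₂ ∷ M₂ ∷ y ∷ [])) , linear c (solve (M₂ ∷ y ∷ []))) ,
      (linear f (solve (n₁ ∷ n₃ ∷ M₁ ∷ M₂ ∷ x ∷ y ∷ [])) ,
       linear (e ⊕ eq≥ zero-sum) (solve (n₁ ∷ n₂ ∷ n₃ ∷ M₁ ∷ M₂ ∷ M₃ ∷ x ∷ y ∷ [])))

  -- `rot` turns (f₁, f₂, f₃) into (-f₃, -f₁, -f₂). The sign exchanges minima and maxima, which
  -- `zero-sum` compensates, so the corner sizes are merely permuted and the second one takes the
  -- role of c.
  rotated : ∀ p → p ∈ₕ hexagon n₁ n₂ n₃ M₁ M₂ M₃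
    ⇔ InH (M₃ - n₃) (M₁ - n₁) (M₁ + n₂ + M₃) (M₁ + n₂ + M₃) (translate (M₃ , - n₁) (rot p))
  rotated (x , y) = mk⇔ to from
    where
    to : (n₁ ≤ x × x ≤ M₁) × (n₂ ≤ - y × - y ≤ M₂) × (n₃ ≤ y - x × y - x ≤ M₃) →
      (0ℤ ≤ x - y + M₃ × x - y + M₃ ≤ M₃ - n₃) × (0ℤ ≤ x + - n₁ × x + - n₁ ≤ M₁ - n₁)
      × (M₁ + n₂ + M₃ - (M₁ - n₁) ≤ x - y + M₃ - (x + - n₁) × x - y + M₃ - (x + - n₁) ≤ M₃ - n₃ - (M₁ + n₂ + M₃))
    to ((a , b) , (c , d) , (e , f)) =
      (linear f (solve (M₃ ∷ x ∷ y ∷ [])) , linear e (solve (n₃ ∷ M₃ ∷ x ∷ y ∷ []))) ,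
      (linear a (solve (n₁ ∷ x ∷ [])) , linear b (solve (n₁ ∷ M₁ ∷ x ∷ []))) ,
      (linear c (solve (n₁ ∷ n₂ ∷ M₁ ∷ M₃ ∷ x ∷ y ∷ [])) ,
       linear (d ⊕ eq≤ zero-sum) (solve (n₁ ∷ n₂ ∷ n₃ ∷ M₁ ∷ M₂ ∷ M₃ ∷ x ∷ y ∷ [])))
    from : (0ℤ ≤ x - y + M₃ × x - y + M₃ ≤ M₃ - n₃) × (0ℤ ≤ x + - n₁ × x + - n₁ ≤ M₁ - n₁)
      × (M₁ + n₂ + M₃ - (M₁ - n₁) ≤ x - y + M₃ - (x + - n₁) × x - y + M₃ - (x + - n₁) ≤ M₃ - n₃ - (M₁ + n₂ + M₃)) →
      (n₁ ≤ x × x ≤ M₁) × (n₂ ≤ - y × - y ≤ M₂) × (n₃ ≤ y - x × y - x ≤ M₃)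
    from ((a , b) , (c , d) , (e , f)) =
      (linear c (solve (n₁ ∷ x ∷ [])) , linear d (solve (n₁ ∷ M₁ ∷ x ∷ []))) ,
      (linear e (solve (n₁ ∷ n₂ ∷ M₁ ∷ M₃ ∷ x ∷ y ∷ [])) ,
       linear (f ⊕ eq≥ zero-sum) (solve (n₁ ∷ n₂ ∷ n₃ ∷ M₁ ∷ M₂ ∷ M₃ ∷ x ∷ y ∷ []))) ,
      (linear b (solve (n₃ ∷ M₃ ∷ x ∷ y ∷ [])) , linear a (solve (M₃ ∷ x ∷ y ∷ [])))

hexagon-shape : ∀ {d H t₁ t₂ t₃} → Truncation H d t₁ t₂ t₃ → downSize H ≡ + d → Balanced t₁ t₂ t₃ →
  t₁ ℕ.+ t₂ ℕ.+ t₃ ≡ d →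
  ∃[ a ] ∃[ b ] ∃[ c ] (a , b , c) ∈ shapes d × ∃[ k ] ∃[ t ]
    (∀ p → p ∈ₕ H ⇔ InH (+ a) (+ b) (+ c) (+ c) (translate t (rotN k p)))
hexagon-shape {d} {hexagon n₁ n₂ n₃ M₁ M₂ M₃} {t₁} {t₂} {t₃} T down≡ balance sum =
  place-shape (balanced⇒shape balance sum)
  where
  open Truncation T
  zero-sum : n₁ + n₂ + n₃ + (M₁ + M₂ + M₃) ≡ 0ℤ
  zero-sum = trans (eq (n₁ + n₂ + n₃) (M₁ + M₂ + M₃))
    (trans (cong₂ _-_ side down≡) (+-inverseʳ (+ d)))
    where
    eq : ∀ a b → a + b ≡ b - - a
    eq = solve-∀

  width : ∀ {a t} → a ℕ.+ t ≡ d → ∀ w z → w ≡ + t → z ≡ M₁ + M₂ + M₃ - w → + a ≡ z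
  width {a} {t} a+t≡d w z w≡t z≡ = sym (begin
    z                      ≡⟨ z≡ ⟩
    M₁ + M₂ + M₃ - w       ≡⟨ cong₂ _-_ side w≡t ⟩
    + d - + t              ≡⟨ cong (λ e → + e - + t) a+t≡d ⟨
    + a + + t - + t        ≡⟨ cancel (+ a) (+ t) ⟩
    + a                    ∎)
    where
    open ≡-Reasoning
    cancel : ∀ a t → a + t - t ≡ a
    cancel = solve-∀

  width₁ : M₁ - n₁ ≡ M₁ + M₂ + M₃ - (n₁ + M₂ + M₃)
  width₁ = solve (n₁ ∷ M₁ ∷ M₂ ∷ M₃ ∷ [])
  width₂ : M₂ - n₂ ≡ M₁ + M₂ + M₃ - (M₁ + n₂ + M₃)
  width₂ = solve (n₂ ∷ M₁ ∷ M₂ ∷ M₃ ∷ [])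
  width₃ : M₃ - n₃ ≡ M₁ + M₂ + M₃ - (M₁ + M₂ + n₃)
  width₃ = solve (n₃ ∷ M₁ ∷ M₂ ∷ M₃ ∷ [])

  relabel : ∀ {P : Set} {α β γ a b c q} → + a ≡ α → + b ≡ β → γ ≡ + c →
    P ⇔ InH α β γ γ q → P ⇔ InH (+ a) (+ b) (+ c) (+ c) q
  relabel refl refl refl equiv = equiv

  place-shape : HasShape d t₁ t₂ t₃ ⊎ HasShape d t₃ t₁ t₂ → _
  place-shape (inj₁ (a , b , a+t₁≡d , b+t₂≡d , abc∈)) = a , b , t₃ , abc∈ , 0 , (- n₁ , M₂) , λ p →
    relabel (width a+t₁≡d _ _ corner₁ width₁) (width b+t₂≡d _ _ corner₂ width₂) corner₃ (translated zero-sum p)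
  place-shape (inj₂ (a , b , a+t₃≡d , b+t₁≡d , abc∈)) = a , b , t₂ , abc∈ , 1 , (M₃ , - n₁) , λ p →
    relabel (width a+t₃≡d _ _ corner₃ width₃) (width b+t₁≡d _ _ corner₁ width₁) corner₂ (rotated zero-sum p)

theorem27 : (d : ℕ) → 1 ℕ.≤ d → (A : List Point) → IsOptimalAnticode d A →
    (length A ≡ ceil3 (d ℕ.* d ℕ.+ 3 ℕ.* d ℕ.+ 2))
    × (∃[ a ] ∃[ b ] ∃[ c ] ((a , b , c) ∈ shapes d × ∃[ k ] ∃[ t ]
    (∀ p → (p ∈ A) ⇔ InH (+ a) (+ b) (+ c) (+ c) (translate t (rotN k p)))))
theorem27 d _ A optimal@(anticode@(unique , _) , maximal) = conclude A refl
  where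
  large : count (+ d) ≤ + 3 * + length A
  large = let B , B-anticode , h = large-anticode d
          in ≤-trans h (*-monoˡ-≤-nonNeg (+ 3) (+≤+ (maximal B B-anticode)))

  cast-X : count (+ d) ≡ + (d ℕ.* d ℕ.+ 3 ℕ.* d ℕ.+ 2)
  cast-X = trans (sym (cast-count d)) (cong +_ (X≡ d))
    where
    X≡ : ∀ d → (1 ℕ.+ d) ℕ.* (2 ℕ.+ d) ≡ d ℕ.* d ℕ.+ 3 ℕ.* d ℕ.+ 2
    X≡ = ℕR.solve-∀

  Goal : Set
  Goal = (length A ≡ ceil3 (d ℕ.* d ℕ.+ 3 ℕ.* d ℕ.+ 2))
    × (∃[ a ] ∃[ b ] ∃[ c ] ((a , b , c) ∈ shapes d × ∃[ k ] ∃[ t ]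
      (∀ p → (p ∈ A) ⇔ InH (+ a) (+ b) (+ c) (+ c) (translate t (rotN k p)))))

  within : ∀ {H s t₁ t₂ t₃} → Hull H A → upSize H ≡ + d → downSize H ≡ + d →
           Truncation H s t₁ t₂ t₃ → s ≡ d → Goal
  within {H} {_} {t₁} {t₂} {t₃} hullHA up≡ down≡ T refl =
    -- Three times the length lies between (d + 1)(d + 2) and its successor, which determines the
    -- length.
    ceil3-unique _ (length A)
      (drop‿+≤+ (subst₂ _≤_ cast-X (sym (pos-* 3 (length A))) large))
      (drop‿+≤+ (subst₂ _≤_ (sym (pos-* 3 (length A))) (cong (λ z → 1ℤ + z) cast-X)
        (count-upper (+ d) (+ t₁) (+ t₂) (+ t₃) (+ length A) sum≡d upper))) ,
    (let a , b , c , abc∈ , k , t , equiv =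
           hexagon-shape T down≡ (spread≤2⇒balanced spread≤2) (+-injective sum≡d)
     in a , b , c , abc∈ , k , t ,
        λ p → ⇔.trans (optimal⇔hexagon optimal hullHA (eq≤ up≡) (eq≤ down≡) p) (equiv p))
    where
    upper : + 2 * + length A + corners (+ t₁) (+ t₂) (+ t₃) ≤ count (+ d)
    upper = hull-count hullHA unique T
    sum≡d : + t₁ + + t₂ + + t₃ ≡ + d
    sum≡d = trans (corner-sum T) (trans (cong₂ (λ u v → u + u - v) up≡ down≡) (eq (+ d)))
      where
      eq : ∀ z → z + z - z ≡ z
      eq = solve-∀
    spread≤2 : spread (+ t₁) (+ t₂) (+ t₃) ≤ + 2
    spread≤2 = count-spread (+ d) (+ t₁) (+ t₂) (+ t₃) (+ length A) sum≡d large upper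

  conclude : ∀ A′ → A′ ≡ A → Goal
  -- A hull needs a point; the empty list is too short to be `large`.
  conclude [] refl = contradiction large (count≰0 d)
  conclude (a ∷ A′) refl =
    let H , hullHA = hull a A′
        up≤ , down≤ = hull-sizes hullHA anticode
        up≡ , down≡ = sizes≡ hullHA unique large up≤ down≤
        s , t₁ , t₂ , t₃ , T = truncate hullHA
    in within hullHA up≡ down≡ T (+-injective (trans (sym (Truncation.side T)) up≡))
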